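{- The problem $\mathrm{PartSynth}(\mathrm{FO}^2[\sim,<])$ is undecidable; that is, there is no algorithm which, given a finite alphabet $A=A_S\uplus A_E$ of actions and a sentence $\varphi\in\mathrm{FO}^2[\sim,<]$ over $A$, decides whether there exist finite disjoint sets of processes $\mathbb{P}_S$ and $\mathbb{P}_E$ (with no shared processes) such that System has a winning strategy for $\varphi$.
   Context: **Data words.** $A$ is a finite alphabet of actions, partitioned into System actions $A_S$ and Environment actions $A_E$. Processes are partitioned between the players: $\mathbb{P}_S$ (System processes) and $\mathbb{P}_E$ (Environment processes) are disjoint finite sets, and there is no shared process. Let $\Sigma_S := A_S\times\mathbb{P}_S$, $\Sigma_E := A_E\times\mathbb{P}_E$, $\Sigma:=\Sigma_S\cup\Sigma_E$. A data word is a finite or infinite sequence $w=(a_0,p_0)(a_1,p_1)\cdots$ over $\Sigma$; each pair $(a_i,p_i)$ in the sequence is called a position. **Logic.** Formulas of $\mathrm{FO}^2[\sim,<]$ are first-order formulas (connectives $\neg,\land,\lor,\exists,\forall$) using only two (reusable) variables $x,y$, built from the atoms $a(x)$ for $a\in A$, $x=y$, $x<y$, $x\sim y$, $\mathbb{P}_S(x)$, $\mathbb{P}_E(x)$ (and $\mathbb{P}_{SE}(x)$, for shared processes, which is interpreted as the empty set here), up to renaming of the two variables; the successor relation is not available. A data word is represented as a structure whose domain has one element for each position and one element for each process in $\mathbb{P}_S\cup\mathbb{P}_E$ (including processes on which no action is played). $\mathbb{P}_S$ (resp. $\mathbb{P}_E$) is interpreted as the set of process elements of System (resp. Environment); $a$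 is interpreted as the set of positions whose action is $a$; $<$ is the linear order on positions; $\sim$ is the equivalence relation such that two positions $(a_i,p_i)$, $(a_j,p_j)$ are related iff $p_i=p_j$, and each process element $p$ is related to all positions of the form $(a,p)$. **Strategies.** A strategy for System is a function $\mathcal{S}:\Sigma^*\to\Sigma_S\cup\{\varepsilon\}$. An execution (data word) $w=\sigma_0\sigma_1\cdots$ is $\mathcal{S}$-compatible if (i) for all $0\le i<|w|$, $\sigma_i\in\Sigma_S$ implies $\sigma_i=\mathcal{S}(\sigma_0\cdots\sigma_{i-1})$, and (ii) if $w$ is finite then $\mathcal{S}(w)=\varepsilon$. It is fair for $\mathcal{S}$ if, whenever there are infinitely many $i$ with $\mathcal{S}(\sigma_0\cdots\sigma_{i-1})\neq\varepsilon$, there are infinitely many positions of $w$ in $\Sigma_S$. $\mathcal{S}$ is winning for $\varphi$ if all executions that are $\mathcal{S}$-compatible and fair for $\mathcal{S}$ satisfy $\varphi$. **Problem.** For a logic $\mathcal{L}$, $\mathrm{PartSynth}(\mathcal{L})$ is the problem: given $A=A_S\uplus A_E$ and a sentence $\varphi\in\mathcal{L}$, decide whether System has a winning strategy for $\varphi$ for some arbitrary finite sets $\mathbb{P}_S$ and $\mathbb{P}_E$ (no shared processes). -}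

module Defs where

open import Data.Bool using (Bool; true; false)
open import Data.Empty using (⊥)
open import Data.Fin using (Fin; toℕ)
open import Data.List using (List; length; lookup; take; applyUpTo)
open import Data.Maybe using (Maybe; just; nothing)
open import Data.Nat using (ℕ; zero; suc; _+_; _≤_; _<_)
open import Data.Product using (Σ; ∃; _×_; _,_; proj₁; proj₂)
open import Data.Sum using (_⊎_; inj₁; inj₂; [_,_])
open import Data.Unit using (⊤; tt)
open import Data.Vec as Vec using (Vec; []; _∷_)
open import Relation.Binary.PropositionalEquality using (_≡_; _≢_)
open import Relation.Nullary using (¬_)

------------------------------------------------------------------------
-- Computability: partial recursive functions

data Rec : ℕ → Set where
  zeroᵣ : Rec 0
  sucᵣ  : Rec 1
  proj  : ∀ {n} → Fin n → Rec n
  comp  : ∀ {m n} → Rec m → Vec (Rec n) m → Rec n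
  prim  : ∀ {n} → Rec n → Rec (suc (suc n)) → Rec (suc n)
  min   : ∀ {n} → Rec (suc n) → Rec n

infix 4 _[_]⇓_ _[_]⇓*_

-- f [ v ]⇓ k: the partial function f is defined on v with value k.
mutual
  data _[_]⇓_ : ∀ {n} → Rec n → Vec ℕ n → ℕ → Set where
    zeroᵣ : zeroᵣ [ [] ]⇓ 0
    sucᵣ  : ∀ {k} → sucᵣ [ k ∷ [] ]⇓ suc k
    proj  : ∀ {n} {i : Fin n} {v} → proj i [ v ]⇓ Vec.lookup v i
    comp  : ∀ {m n} {f : Rec m} {gs : Vec (Rec n) m} {v u k} →
            gs [ v ]⇓* u → f [ u ]⇓ k → comp f gs [ v ]⇓ k
    prim0 : ∀ {n} {f : Rec n} {g v k} →
            f [ v ]⇓ k → prim f g [ 0 ∷ v ]⇓ k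
    primS : ∀ {n} {f : Rec n} {g v i r k} →
            prim f g [ i ∷ v ]⇓ r → g [ i ∷ r ∷ v ]⇓ k →
            prim f g [ suc i ∷ v ]⇓ k
    min   : ∀ {n} {f : Rec (suc n)} {v k} →
            f [ k ∷ v ]⇓ 0 →
            (∀ i → i < k → ∃ λ r → f [ i ∷ v ]⇓ suc r) →
            min f [ v ]⇓ k

  data _[_]⇓*_ {n} : ∀ {m} → Vec (Rec n) m → Vec ℕ n → Vec ℕ m → Set where
    []  : ∀ {v} → [] [ v ]⇓* []
    _∷_ : ∀ {m f} {gs : Vec (Rec n) m} {v k u} →
          f [ v ]⇓ k → gs [ v ]⇓* u → (f ∷ gs) [ v ]⇓* (k ∷ u)

Decides : {X : Set} → (X → ℕ) → (X → Set) → Rec 1 → Set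
Decides code P f =
  ∀ x → (P x → f [ code x ∷ [] ]⇓ 1) × (¬ P x → f [ code x ∷ [] ]⇓ 0)

Undecidable : {X : Set} → (X → ℕ) → (X → Set) → Set
Undecidable code P = ¬ (∃ λ (f : Rec 1) → Decides code P f)

------------------------------------------------------------------------
-- Syntax of FO²[∼,<]

-- Finite sets are taken up to bijection, i.e. of the form Fin n.
record Alphabet : Set where
  constructor alphabet
  field
    #S #E : ℕ

  Aₛ Aₑ Action : Set
  Aₛ     = Fin #S
  Aₑ     = Fin #E
  Action = Aₛ ⊎ Aₑ

open Alphabet public using (Action)

-- In Var a b and Formula a b, the variable x (resp. y) may occur free
-- only if a (resp. b) is true.
data Var : Bool → Bool → Set where
  x : ∀ {b} → Var true b
  y : ∀ {a} → Var a true

infix  8 _≐_ _≺_ _∼_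
infixr 7 _∧̇_
infixr 6 _∨̇_

data Formula (A : Alphabet) (a b : Bool) : Set where
  act             : Action A → Var a b → Formula A a b
  _≐_ _≺_ _∼_     : Var a b → Var a b → Formula A a b
  sys env shared  : Var a b → Formula A a b
  ¬̇_              : Formula A a b → Formula A a b
  _∧̇_ _∨̇_         : Formula A a b → Formula A a b → Formula A a b
  ∃x ∀x           : Formula A true b → Formula A a b
  ∃y ∀y           : Formula A a true → Formula A a b

Sentence : Alphabet → Set
Sentence A = Formula A false false

------------------------------------------------------------------------
-- Data words and strategies

module Game (A : Alphabet) (p q : ℕ) where
  open Alphabet A using (Aₛ; Aₑ)

  Pₛ Pₑ Process Σₛ Σₑ Letter : Set
  Pₛ      = Fin p
  Pₑ      = Fin q
  Process = Pₛ ⊎ Pₑ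
  Σₛ      = Aₛ × Pₛ
  Σₑ      = Aₑ × Pₑ
  Letter  = Σₛ ⊎ Σₑ

  action : Letter → Action A
  action (inj₁ (a , _)) = inj₁ a
  action (inj₂ (a , _)) = inj₂ a

  process : Letter → Process
  process (inj₁ (_ , r)) = inj₁ r
  process (inj₂ (_ , r)) = inj₂ r

  data Word : Set where
    fin : List Letter → Word
    inf : (ℕ → Letter) → Word

  Pos : Word → Set
  Pos (fin u) = Fin (length u)
  Pos (inf s) = ℕ

  index : ∀ w → Pos w → ℕ
  index (fin u) i = toℕ i
  index (inf s) i = i

  letter : ∀ w → Pos w → Letter
  letter (fin u) = lookup u
  letter (inf s) = s

  -- The prefix of w strictly before a position.
  before : ∀ w → Pos w → List Letter
  before (fin u) i = take (toℕ i) u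
  before (inf s) i = applyUpTo s i

  -- Classical reading: the existential is double-negated.
  InfinitelyMany : ∀ w → (Pos w → Set) → Set
  InfinitelyMany w P = ∀ n → ¬ ¬ (∃ λ i → n ≤ index w i × P i)

  Strategy : Set
  Strategy = List Letter → Maybe Σₛ

  Compatible : Strategy → Word → Set
  Compatible S w =
      (∀ i σ → letter w i ≡ inj₁ σ → S (before w i) ≡ just σ)
    × (∀ u → w ≡ fin u → S u ≡ nothing)

  Fair : Strategy → Word → Set
  Fair S w =
    InfinitelyMany w (λ i → S (before w i) ≢ nothing) →
    InfinitelyMany w (λ i → ∃ λ σ → letter w i ≡ inj₁ σ)

  ----------------------------------------------------------------------
  -- Semantics of formulas

  module Structure (w : Word) where

    Element : Set
    Element = Pos w ⊎ Process

    owner : Element → Process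
    owner = [ (λ i → process (letter w i)) , (λ r → r) ]

    HasAction : Action A → Element → Set
    HasAction a (inj₁ i) = action (letter w i) ≡ a
    HasAction a (inj₂ _) = ⊥

    Before : Element → Element → Set
    Before (inj₁ i) (inj₁ j) = index w i < index w j
    Before _        _        = ⊥

    Sys Env : Element → Set
    Sys e = ∃ λ r → e ≡ inj₂ (inj₁ r)
    Env e = ∃ λ r → e ≡ inj₂ (inj₂ r)

    Value : Bool → Set
    Value true  = Element
    Value false = ⊤

    Assignment : Bool → Bool → Set
    Assignment a b = Value a × Value b

    ⟦_⟧ : ∀ {a b} → Var a b → Assignment a b → Element
    ⟦ x ⟧ = proj₁
    ⟦ y ⟧ = proj₂

    -- Truth is classical: ∨ and ∃ are double-negated, so that every
    -- clause is stable under double negation.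
    Sat : ∀ {a b} → Assignment a b → Formula A a b → Set
    Sat ρ (act a v)   = HasAction a (⟦ v ⟧ ρ)
    Sat ρ (v ≐ v′)    = ⟦ v ⟧ ρ ≡ ⟦ v′ ⟧ ρ
    Sat ρ (v ≺ v′)    = Before (⟦ v ⟧ ρ) (⟦ v′ ⟧ ρ)
    Sat ρ (v ∼ v′)    = owner (⟦ v ⟧ ρ) ≡ owner (⟦ v′ ⟧ ρ)
    Sat ρ (sys v)     = Sys (⟦ v ⟧ ρ)
    Sat ρ (env v)     = Env (⟦ v ⟧ ρ)
    Sat ρ (shared v)  = ⊥
    Sat ρ (¬̇ φ)       = ¬ Sat ρ φ
    Sat ρ (φ ∧̇ ψ)     = Sat ρ φ × Sat ρ ψ
    Sat ρ (φ ∨̇ ψ)     = ¬ ¬ (Sat ρ φ ⊎ Sat ρ ψ)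
    Sat (e , f) (∃x φ) = ¬ ¬ (∃ λ d → Sat (d , f) φ)
    Sat (e , f) (∀x φ) = ∀ d → Sat (d , f) φ
    Sat (e , f) (∃y φ) = ¬ ¬ (∃ λ d → Sat (e , d) φ)
    Sat (e , f) (∀y φ) = ∀ d → Sat (e , d) φ

  infix 4 _⊨_

  _⊨_ : Word → Sentence A → Set
  w ⊨ φ = Structure.Sat w (tt , tt) φ

  Winning : Strategy → Sentence A → Set
  Winning S φ = ∀ w → Compatible S w → Fair S w → w ⊨ φ

------------------------------------------------------------------------
-- The synthesis problem

Instance : Set
Instance = Σ Alphabet Sentence

PartSynth : Instance → Set
PartSynth (A , φ) =
  ∃ λ p → ∃ λ q → ∃ λ (S : Game.Strategy A p q) → Game.Winning A p q S φ

------------------------------------------------------------------------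
-- Numbering of instances

triangle : ℕ → ℕ
triangle zero    = 0
triangle (suc n) = suc n + triangle n

-- Cantor's pairing bijection.
⟨_,_⟩ : ℕ → ℕ → ℕ
⟨ m , n ⟩ = triangle (m + n) + n

codeAction : ∀ {A} → Action A → ℕ
codeAction (inj₁ i) = ⟨ 0 , toℕ i ⟩
codeAction (inj₂ i) = ⟨ 1 , toℕ i ⟩

codeVar : ∀ {a b} → Var a b → ℕ
codeVar x = 0
codeVar y = 1

codeFormula : ∀ {A a b} → Formula A a b → ℕ
codeFormula {A} (act a v) = ⟨ 0 , ⟨ codeAction {A} a , codeVar v ⟩ ⟩
codeFormula (v ≐ v′)      = ⟨ 1 , ⟨ codeVar v , codeVar v′ ⟩ ⟩
codeFormula (v ≺ v′)      = ⟨ 2 , ⟨ codeVar v , codeVar v′ ⟩ ⟩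
codeFormula (v ∼ v′)      = ⟨ 3 , ⟨ codeVar v , codeVar v′ ⟩ ⟩
codeFormula (sys v)       = ⟨ 4 , codeVar v ⟩
codeFormula (env v)       = ⟨ 5 , codeVar v ⟩
codeFormula (shared v)    = ⟨ 6 , codeVar v ⟩
codeFormula (¬̇ φ)         = ⟨ 7 , codeFormula φ ⟩
codeFormula (φ ∧̇ ψ)       = ⟨ 8 , ⟨ codeFormula φ , codeFormula ψ ⟩ ⟩
codeFormula (φ ∨̇ ψ)       = ⟨ 9 , ⟨ codeFormula φ , codeFormula ψ ⟩ ⟩
codeFormula (∃x φ)        = ⟨ 10 , codeFormula φ ⟩
codeFormula (∀x φ)        = ⟨ 11 , codeFormula φ ⟩
codeFormula (∃y φ)        = ⟨ 12 , codeFormula φ ⟩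
codeFormula (∀y φ)        = ⟨ 13 , codeFormula φ ⟩

code : Instance → ℕ
code (A , φ) = ⟨ Alphabet.#S A , ⟨ Alphabet.#E A , codeFormula φ ⟩ ⟩

{-# OPTIONS --safe #-}

-- Given a recursive function F of two arguments, there is for all m and d
-- a sentence for which System wins if F m d = 0 and loses if F m d > 0.
-- For F m d = f (code of the instance with alphabet size m whose sentence
-- is the conjunction of the one with code d and of the formula fixing the
-- inputs m and d), where f is a supposed decision procedure, m and d can be
-- chosen such that F is evaluated on the instance itself, and f errs on it.
--
-- F is compiled to a counter machine, and System has to play a run of it.
-- System increments a register by a move on a fresh process and decrements
-- it by a move on the process of an unmatched increment.  The only thing
-- Environment can do is to interrupt System.  The sentence constrains the
-- moves before the first interruption, hence every finite prefix of the run
-- must satisfy it.  The last and the last but one position of a prefix are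
-- definable without the successor relation, which is all it takes to check
-- the jumps and the tests for zero.
module Submission where

open import Defs

open import Data.Bool using (Bool; true; false)
open import Data.Empty using (⊥; ⊥-elim)
open import Data.Fin as Fin using (Fin; zero; suc; toℕ; fromℕ; fromℕ<; _↑ˡ_)
open import Data.Fin.Properties as Fin
  using (toℕ-injective; toℕ<n; toℕ-fromℕ; toℕ-fromℕ<; toℕ-↑ˡ)
open import Data.List using (List; []; _∷_; _++_; _∷ʳ_; length; head; drop; take; applyUpTo)
open import Data.List.Properties
  using (length-++; length-take; length-applyUpTo; lookup-applyUpTo; applyUpTo-∷ʳ)
open import Data.List.Relation.Unary.All as ListAll using ([]; _∷_)
open import Data.List.Relation.Unary.All.Properties using (drop⁺)
open import Data.Maybe using (Maybe; just; nothing; fromMaybe; maybe)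
open import Data.Nat
open import Data.Nat.Induction using (<-rec)
open import Data.Nat.Properties
open import Data.Product using (∃; ∃₂; _×_; _,_; proj₁; proj₂)
open import Data.Sum using (_⊎_; inj₁; inj₂)
open import Data.Sum.Properties using (inj₁-injective; ≡-dec)
open import Data.Unit using (⊤; tt)
open import Data.Vec as Vec using (Vec; []; _∷_; lookup)
open import Data.Vec.Properties using (lookup-map)
open import Data.Vec.Relation.Unary.All as VecAll using ([]; _∷_)
open import Data.Vec.Relation.Unary.All.Properties using (lookup⁺)
open import Function using (_∘_; id)
open import Relation.Binary.Definitions using (DecidableEquality; tri<; tri≈; tri>)
open import Relation.Binary.PropositionalEquality
open import Relation.Nullary
open import Relation.Nullary.Negation using (Stable)
open import Relation.Nullary.Decidable using (decidable-stable)


-- Computable functions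

-- A test for zero relates three positions: the test, an earlier increment, and a decrement on the
-- same process in between. With two variables this can be said if the test is the last position,
-- for then "in between" is just "after the increment". Likewise, consecutive positions can be
-- singled out by counting from the end. As System cannot foresee the challenge, each of its moves
-- has to pass the checks made at the end of a prefix. Process sets of arbitrary size do no harm. A
-- run that halts needs only finitely many processes, and a run that does not halt is lost with any
-- number of them, since an unchallenged play must show the halting letter. The sentence itself asks
-- for an Environment process; without one, no challenge would be possible. The choice of `m` and
-- `d` is not circular: the conjunct with code `d` depends on the compiled machine only, and the
-- inputs occur only in the other conjunct, whose code is computable from `m` and `d`. The inputs
-- are loaded in unary by the first `m + d` moves, which `atLeast` locates.

Computable : ∀ {n} → (Vec ℕ n → ℕ) → Set
Computable {n} F = ∃ λ (f : Rec n) → ∀ v → f [ v ]⇓ F v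

projᶜ : ∀ {n} (i : Fin n) → Computable λ v → lookup v i
projᶜ i = proj i , λ _ → proj

sucᶜ : ∀ {n} {F : Vec ℕ n → ℕ} → Computable F → Computable (suc ∘ F)
sucᶜ (f , f⇓) = comp sucᵣ (f ∷ []) , λ v → comp (f⇓ v ∷ []) sucᵣ

constᶜ : ∀ {n} k → Computable {n} λ _ → k
constᶜ zero    = comp zeroᵣ [] , λ _ → comp [] zeroᵣ
constᶜ (suc k) = sucᶜ (constᶜ k)

compᶜ₁ : ∀ {n} {F : Vec ℕ n → ℕ} (G : ℕ → ℕ) →
         Computable (G ∘ Vec.head) → Computable F → Computable (G ∘ F)
compᶜ₁ _ (g , g⇓) (f , f⇓) = comp g (f ∷ []) , λ v → comp (f⇓ v ∷ []) (g⇓ _)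

-- Meant for the code of `atLeast l`, which arises by iterating one fixed function `l` times.
iterateᶜ : (F : ℕ → ℕ) {H : ℕ → ℕ} → (∀ k → F (suc k) ≡ H (F k)) →
           Computable (H ∘ Vec.head) → Computable (F ∘ Vec.head)
iterateᶜ F {H} F-suc (h , h⇓) = prim (proj₁ (constᶜ {0} (F 0))) step , λ { (k ∷ []) → eval k }
  where
  step : Rec 2
  step = comp h (proj (suc zero) ∷ [])
  eval : ∀ k → prim (proj₁ (constᶜ (F 0))) step [ k ∷ [] ]⇓ F k
  eval zero    = prim0 (proj₂ (constᶜ (F 0)) [])
  eval (suc k) = subst (prim _ step [ suc k ∷ [] ]⇓_) (sym (F-suc k))
    (primS (eval k) (comp (proj ∷ []) (h⇓ (F k ∷ []))))

+ᶜ : ∀ {n} {F G : Vec ℕ n → ℕ} →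
     Computable F → Computable G → Computable λ v → F v + G v
+ᶜ {F = F} {G} (f , f⇓) (g , g⇓) =
  comp add (f ∷ g ∷ []) , λ v → comp (f⇓ v ∷ g⇓ v ∷ []) (eval (F v) (G v))
  where
  add : Rec 2
  add = prim (proj zero) (comp sucᵣ (proj (suc zero) ∷ []))
  eval : ∀ m n → add [ m ∷ n ∷ [] ]⇓ m + n
  eval zero    n = prim0 proj
  eval (suc m) n = primS (eval m n) (comp (proj ∷ []) sucᵣ)

triangleᶜ : Computable (triangle ∘ Vec.head)
triangleᶜ = prim zeroᵣ (proj₁ stepᶜ) , λ { (k ∷ []) → eval k }
  where
  stepᶜ : Computable {2} λ v → suc (lookup v zero) + lookup v (suc zero)
  stepᶜ = +ᶜ (sucᶜ (projᶜ zero)) (projᶜ (suc zero))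
  eval : ∀ k → prim zeroᵣ (proj₁ stepᶜ) [ k ∷ [] ]⇓ triangle k
  eval zero    = prim0 zeroᵣ
  eval (suc k) = primS (eval k) (proj₂ stepᶜ (k ∷ triangle k ∷ []))

⟨,⟩ᶜ : ∀ {n} {F G : Vec ℕ n → ℕ} →
       Computable F → Computable G → Computable λ v → ⟨ F v , G v ⟩
⟨,⟩ᶜ f g = +ᶜ (compᶜ₁ triangle triangleᶜ (+ᶜ f g)) g

⟨_,⟩ᶜ : ∀ {n} {F : Vec ℕ n → ℕ} m → Computable F → Computable λ v → ⟨ m , F v ⟩
⟨ m ,⟩ᶜ = ⟨,⟩ᶜ (constᶜ m)

-- Compilation of recursive functions to loop programs

Store : Set
Store = ℕ → ℕ

module _ {X : Set} where

  infixl 9 _[_≔_]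

  _[_≔_] : (ℕ → X) → ℕ → X → ℕ → X
  (σ [ r ≔ k ]) r′ with r ≟ r′
  ... | yes _ = k
  ... | no  _ = σ r′

  update-same : ∀ (σ : ℕ → X) r {k} → (σ [ r ≔ k ]) r ≡ k
  update-same σ r with r ≟ r
  ... | yes _  = refl
  ... | no r≢r = ⊥-elim (r≢r refl)

  update-other : ∀ (σ : ℕ → X) {r r′ k} → r ≢ r′ → (σ [ r ≔ k ]) r′ ≡ σ r′
  update-other σ {r} {r′} r≢r′ with r ≟ r′
  ... | yes r≡r′ = ⊥-elim (r≢r′ r≡r′)
  ... | no  _    = refl

infixr 5 _⨟_
infix  4 _⊢_⇒_

data Prog : Set where
  inc   : ℕ → Prog
  _⨟_   : Prog → Prog → Prog
  while : ℕ → Prog → Prog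

-- The test of a loop decrements the register, so the body starts with
-- the predecessor of the value tested.
data _⊢_⇒_ : Prog → Store → Store → Set where
  inc  : ∀ {r σ} → inc r ⊢ σ ⇒ σ [ r ≔ suc (σ r) ]
  _⨟_  : ∀ {P Q σ τ υ} → P ⊢ σ ⇒ τ → Q ⊢ τ ⇒ υ → P ⨟ Q ⊢ σ ⇒ υ
  stop : ∀ {r P σ} → σ r ≡ 0 → while r P ⊢ σ ⇒ σ
  loop : ∀ {r P σ τ υ k} → σ r ≡ suc k →
         P ⊢ σ [ r ≔ k ] ⇒ τ → while r P ⊢ τ ⇒ υ → while r P ⊢ σ ⇒ υ

infix 4 _≗_below_

_≗_below_ : Store → Store → ℕ → Set
τ ≗ σ below b = ∀ {r} → r < b → τ r ≡ σ r

-- P computes k in register b; the registers above b are scratch space.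
record Computes (P : Prog) (σ : Store) (b k : ℕ) : Set where
  constructor computes
  field
    {final} : Store
    run     : P ⊢ σ ⇒ final
    result  : final b ≡ k
    frame   : final ≗ σ below b

drain : ℕ → ℕ → Prog
drain r t = while r (inc t)

record Drained (r t : ℕ) (σ : Store) : Set where
  constructor drained
  field
    {final} : Store
    run     : drain r t ⊢ σ ⇒ final
    source  : final r ≡ 0
    target  : final t ≡ σ r + σ t
    others  : ∀ {r′} → r ≢ r′ → t ≢ r′ → final r′ ≡ σ r′

drain-run : ∀ {r t} → r ≢ t → ∀ σ → Drained r t σ
drain-run {r} {t} r≢t σ = go _ σ refl
  where
  go : ∀ k σ → σ r ≡ k → Drained r t σ
  go zero    σ σr = drained (stop σr) σr (cong (_+ σ t) (sym σr)) λ _ _ → refl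
  go (suc k) σ σr =
    let τ = σ [ r ≔ k ]
        τr : τ r ≡ k
        τr = update-same σ r
        τt : τ t ≡ σ t
        τt = update-other σ r≢t
        υ = τ [ t ≔ suc (τ t) ]
        drained run source target others = go k υ (trans (update-other τ (≢-sym r≢t)) τr)
    in drained (loop σr inc run) source
         (begin
            _                ≡⟨ target ⟩
            υ r + υ t        ≡⟨ cong₂ _+_ (trans (update-other τ (≢-sym r≢t)) τr) (update-same τ t) ⟩
            k + suc (τ t)    ≡⟨ +-suc k (τ t) ⟩
            suc k + τ t      ≡⟨ cong₂ _+_ (sym σr) τt ⟩
            σ r + σ t        ∎)
         λ r≢ t≢ → trans (others r≢ t≢) (trans (update-other τ t≢) (update-other σ r≢))
    where open ≡-Reasoning

-- A loop needs a nonempty body, `Prog` having no empty program; the body increments the scratch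
-- register `suc b`.
clear : ℕ → Prog
clear b = drain b (suc b)

clear-run : ∀ b σ → Computes (clear b) σ b 0
clear-run b σ =
  let drained run source _ others = drain-run (<⇒≢ (n<1+n b)) σ
  in computes run source λ r<b → others (>⇒≢ r<b) (>⇒≢ (m<n⇒m<1+n r<b))

-- Reading `r` by a loop empties it, so a second copy is collected in `suc b` and moved back to `r`.
copy : ℕ → ℕ → Prog
copy r b = clear b ⨟ clear (suc b) ⨟ while r (inc b ⨟ inc (suc b)) ⨟ drain (suc b) r

copy-run : ∀ {r b} → r < b → ∀ σ → Computes (copy r b) σ b (σ r)
copy-run {r} {b} r<b σ =
  let computes run₁ b₁ frame₁ = clear-run b σ
      computes {σ₂} run₂ b+1₂ frame₂ = clear-run (suc b) _
      (σ₃ , run₃ , b₃ , b+1₃ , r₃ , frame₃) = go _ σ₂ refl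
      drained run₄ _ r₄ frame₄ = drain-run b+1≢r σ₃
      b₂ = trans (frame₂ (n<1+n b)) b₁
      r₂ = trans (frame₂ (m<n⇒m<1+n r<b)) (frame₁ r<b)
  in computes (run₁ ⨟ run₂ ⨟ run₃ ⨟ run₄)
       (begin
          _          ≡⟨ frame₄ (1+n≢n) (<⇒≢ r<b) ⟩
          σ₃ b       ≡⟨ b₃ ⟩
          σ₂ r + σ₂ b ≡⟨ cong₂ _+_ r₂ b₂ ⟩
          σ r + 0    ≡⟨ +-identityʳ _ ⟩
          σ r        ∎)
       λ {r′} r′<b → case-r r′ r′<b r₄ frame₄ (begin
          σ₃ (suc b) + σ₃ r      ≡⟨ cong₂ _+_ b+1₃ r₃ ⟩
          σ₂ r + σ₂ (suc b) + 0  ≡⟨ +-identityʳ _ ⟩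
          σ₂ r + σ₂ (suc b)      ≡⟨ cong₂ _+_ r₂ b+1₂ ⟩
          σ r + 0                ≡⟨ +-identityʳ _ ⟩
          σ r                    ∎)
          (λ r≢r′ → trans (frame₃ r≢r′ (>⇒≢ r′<b) (>⇒≢ (m<n⇒m<1+n r′<b)))
             (trans (frame₂ (m<n⇒m<1+n r′<b)) (frame₁ r′<b)))
  where
  open ≡-Reasoning
  b+1≢r : suc b ≢ r
  b+1≢r = >⇒≢ (m<n⇒m<1+n r<b)
  case-r : ∀ {k} {τ ρ : Store} r′ → r′ < b → τ r ≡ k →
           (∀ {m} → suc b ≢ m → r ≢ m → τ m ≡ ρ m) →
           k ≡ σ r → (r ≢ r′ → ρ r′ ≡ σ r′) → τ r′ ≡ σ r′
  case-r r′ r′<b τr τ-others k≡ ρ-others with r ≟ r′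
  ... | yes refl = trans τr k≡
  ... | no r≢r′  = trans (τ-others (>⇒≢ (m<n⇒m<1+n r′<b)) r≢r′) (ρ-others r≢r′)
  go : ∀ k σ → σ r ≡ k → ∃ λ τ → (while r (inc b ⨟ inc (suc b)) ⊢ σ ⇒ τ) ×
       τ b ≡ σ r + σ b × τ (suc b) ≡ σ r + σ (suc b) × τ r ≡ 0 ×
       (∀ {r′} → r ≢ r′ → b ≢ r′ → suc b ≢ r′ → τ r′ ≡ σ r′)
  go zero σ σr =
    σ , stop σr , cong (_+ σ b) (sym σr) , cong (_+ σ (suc b)) (sym σr) , σr , λ _ _ _ → refl
  go (suc k) σ σr =
    let σ₁ = σ [ r ≔ k ]
        σ₂ = σ₁ [ b ≔ suc (σ₁ b) ]
        σ₃ = σ₂ [ suc b ≔ suc (σ₂ (suc b)) ]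
        b≢ = <⇒≢ (n<1+n b)
        r₃ : σ₃ r ≡ k
        r₃ = trans (update-other σ₂ b+1≢r) (trans (update-other σ₁ (>⇒≢ r<b)) (update-same σ r))
        b₃ : σ₃ b ≡ suc (σ b)
        b₃ = trans (update-other σ₂ (≢-sym b≢))
               (trans (update-same σ₁ b) (cong suc (update-other σ (<⇒≢ r<b))))
        b+1₃ : σ₃ (suc b) ≡ suc (σ (suc b))
        b+1₃ = trans (update-same σ₂ (suc b)) (cong suc
                 (trans (update-other σ₁ b≢) (update-other σ (≢-sym b+1≢r))))
        (τ , run , τb , τb+1 , τr , others) = go k σ₃ r₃
        add : ∀ {m} → σ₃ m ≡ suc (σ m) → τ m ≡ σ₃ r + σ₃ m → τ m ≡ σ r + σ m
        add {m} σ₃m τm = begin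
          τ m            ≡⟨ τm ⟩
          σ₃ r + σ₃ m    ≡⟨ cong₂ _+_ r₃ σ₃m ⟩
          k + suc (σ m)  ≡⟨ +-suc k (σ m) ⟩
          suc k + σ m    ≡⟨ cong (_+ σ m) (sym σr) ⟩
          σ r + σ m      ∎
    in τ , loop σr (inc ⨟ inc) run , add b₃ τb , add b+1₃ τb+1 , τr ,
       λ r≢ b≢ sb≢ → trans (others r≢ b≢ sb≢) (trans (update-other σ₂ sb≢)
          (trans (update-other σ₁ b≢) (update-other σ r≢)))

registers : ℕ → ∀ n → Vec ℕ n
registers b zero    = []
registers b (suc n) = b ∷ registers (suc b) n

map-frame : ∀ {n σ τ b} {rs : Vec ℕ n} → VecAll.All (_< b) rs → τ ≗ σ below b →
            Vec.map τ rs ≡ Vec.map σ rs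
map-frame []           eq = refl
map-frame (r<b ∷ rs<b) eq = cong₂ _∷_ (eq r<b) (map-frame rs<b eq)

all-≤ : ∀ {n b c} {rs : Vec ℕ n} → b ≤ c → VecAll.All (_< b) rs → VecAll.All (_< c) rs
all-≤ b≤c = VecAll.map (λ r<b → ≤-trans r<b b≤c)

registers-< : ∀ b n → VecAll.All (_< b + n) (registers b n)
registers-< b zero    = []
registers-< b (suc n) rewrite +-suc b n = s≤s (m≤m+n b n) ∷ registers-< (suc b) n

-- compile f rs b evaluates f on the registers rs into register b, and
-- compile* gs rs b evaluates gs into the registers from b onwards.
mutual
  compile : ∀ {n} → Rec n → Vec ℕ n → ℕ → Prog
  compile zeroᵣ           _        b = clear b
  compile sucᵣ            (r ∷ []) b = copy r b ⨟ inc b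
  compile (proj i)        rs       b = copy (lookup rs i) b
  compile (comp {m} f gs) rs       b =
    let c = suc b + m in
    -- What follows the arguments is passed as a continuation, as there is no empty program for an
    -- empty `gs`. The old content of `b` is discarded into `suc c` before the value in `c` is moved
    -- to `b`.
    compile* gs rs (suc b) (compile f (registers (suc b) m) c ⨟ drain b (suc c) ⨟ drain c b)
  compile (prim f g)      (r ∷ rs) b =
    -- Register `b` is the accumulator, `1 + b` the number of iterations left, and `2 + b` the
    -- current index.
    compile f rs b ⨟ copy r (1 + b) ⨟ clear (2 + b) ⨟ while (1 + b) (prim-body g rs b)
  compile (min f)         rs       b =
    clear b ⨟ compile f (b ∷ rs) (1 + b) ⨟ while (1 + b) (inc b ⨟ compile f (b ∷ rs) (1 + b))

  prim-body : ∀ {n} → Rec (2 + n) → Vec ℕ n → ℕ → Prog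
  prim-body g rs b =
    compile g ((2 + b) ∷ b ∷ rs) (3 + b) ⨟ drain b (4 + b) ⨟ drain (3 + b) b ⨟ inc (2 + b)

  compile* : ∀ {m n} → Vec (Rec n) m → Vec ℕ n → ℕ → Prog → Prog
  compile* []       _  _ Q = Q
  compile* (g ∷ gs) rs b Q = compile g rs b ⨟ compile* gs rs (suc b) Q

Correct : ∀ {n} → Rec n → Set
Correct f = ∀ {rs v b k σ} → VecAll.All (_< b) rs → Vec.map σ rs ≡ v → f [ v ]⇓ k →
            Computes (compile f rs b) σ b k

-- A derivation for `prim` has its last iteration outermost, a run of `while` its first. Hence `go`
-- returns a function that completes a run of the remaining loop to a run of the whole program.
prim-correct : ∀ {n} {f : Rec n} {g} → Correct f → Correct g → Correct (prim f g)
prim-correct {f = f} {g} f-correct g-correct {r ∷ rs} {b = b} {k} {σ} (r<b ∷ rs<b) refl f⇓ =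
  let _ , run , τb , τc , _ , frame = go f⇓ 0 (+-identityʳ _)
  in computes (run (stop τc)) τb frame
  where
  W = while (1 + b) (prim-body g rs b)
  v = Vec.map σ rs
  -- The state when the loop is at index i, with m iterations to go.
  go : ∀ {i k} → prim f g [ i ∷ v ]⇓ k → ∀ m → i + m ≡ σ r → ∃ λ τ →
       (∀ {υ} → W ⊢ τ ⇒ υ → compile (prim f g) (r ∷ rs) b ⊢ σ ⇒ υ) ×
       τ b ≡ k × τ (1 + b) ≡ m × τ (2 + b) ≡ i × τ ≗ σ below b
  go (prim0 f⇓) m refl =
    let computes run₁ b₁ frame₁ = f-correct rs<b refl f⇓
        computes run₂ c₂ frame₂ = copy-run {b = 1 + b} (m<n⇒m<1+n r<b) _
        computes run₃ i₃ frame₃ = clear-run (2 + b) _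
    in _ , (λ run → run₁ ⨟ run₂ ⨟ run₃ ⨟ run)
       , trans (frame₃ (m<n⇒m<1+n (n<1+n b))) (trans (frame₂ (n<1+n b)) b₁)
       , trans (frame₃ (n<1+n (1 + b))) (trans c₂ (frame₁ r<b))
       , i₃
       , λ r<b → trans (frame₃ (m<n⇒m<1+n (m<n⇒m<1+n r<b))) (trans (frame₂ (m<n⇒m<1+n r<b)) (frame₁ r<b))
  go {k = k} (primS {i = i} {r = a} rec g⇓) m i+m =
    let τ , run , τb , τc , τi , frame = go rec (suc m) (trans (+-suc i m) i+m)
        τ₀ = τ [ 1 + b ≔ m ]
        frame₀ : ∀ {r} → r ≢ 1 + b → τ₀ r ≡ τ r
        frame₀ r≢ = update-other τ (≢-sym r≢)
        computes {τ₁} run₁ k₁ frame₁ = g-correct {rs = (2 + b) ∷ b ∷ rs} {b = 3 + b} {σ = τ₀}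
          (n<1+n _ ∷ s≤s (m≤n+m b 2) ∷ all-≤ (m≤n+m b 3) rs<b)
          (cong₂ _∷_ (trans (frame₀ 1+n≢n) τi) (cong₂ _∷_ (trans (frame₀ (<⇒≢ (n<1+n b))) τb)
            (trans (map-frame rs<b (λ r<b → frame₀ (<⇒≢ (m<n⇒m<1+n r<b)))) (map-frame rs<b frame))))
          g⇓
        drained {τ₂} run₂ b₂ _ others₂ = drain-run {b} {4 + b} (<⇒≢ (s≤s (m≤n+m b 3))) τ₁
        drained {τ₃} run₃ _ b₃ others₃ = drain-run {3 + b} {b} (>⇒≢ (s≤s (m≤n+m b 2))) τ₂
        τ₄ = τ₃ [ 2 + b ≔ suc (τ₃ (2 + b)) ]
        keep : ∀ {r} → r < 3 + b → b ≢ r → r ≢ 2 + b → τ₄ r ≡ τ₀ r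
        keep r<3+b b≢r r≢2+b = trans (update-other τ₃ (≢-sym r≢2+b))
          (trans (others₃ (>⇒≢ r<3+b) b≢r) (trans (others₂ b≢r (>⇒≢ (m<n⇒m<1+n r<3+b))) (frame₁ r<3+b)))
        open ≡-Reasoning
    in τ₄ , (λ run′ → run (loop τc (run₁ ⨟ run₂ ⨟ run₃ ⨟ inc) run′))
     , (begin
          τ₄ b                ≡⟨ update-other τ₃ (>⇒≢ (s≤s (m≤n+m b 1))) ⟩
          τ₃ b                ≡⟨ b₃ ⟩
          τ₂ (3 + b) + τ₂ b   ≡⟨ cong₂ _+_ (others₂ (<⇒≢ (s≤s (m≤n+m b 2))) (>⇒≢ (n<1+n (3 + b)))) b₂ ⟩
          τ₁ (3 + b) + 0      ≡⟨ +-identityʳ _ ⟩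
          τ₁ (3 + b)          ≡⟨ k₁ ⟩
          k                   ∎)
     , trans (keep (s≤s (m≤n+m (1 + b) 1)) (<⇒≢ (n<1+n b)) (<⇒≢ (n<1+n _))) (update-same τ (1 + b))
     , trans (update-same τ₃ (2 + b)) (cong suc
         (trans (others₃ (>⇒≢ (n<1+n _)) (<⇒≢ (s≤s (m≤n+m b 1))))
         (trans (others₂ (<⇒≢ (s≤s (m≤n+m b 1))) (>⇒≢ (s≤s (m≤n+m _ 1))))
         (trans (frame₁ (n<1+n _)) (trans (frame₀ 1+n≢n) τi)))))
     , λ r<b → trans (keep (≤-trans r<b (m≤n+m b 3)) (>⇒≢ r<b) (<⇒≢ (≤-trans r<b (m≤n+m b 2))))
         (trans (frame₀ (<⇒≢ (m<n⇒m<1+n r<b))) (frame r<b))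

min-correct : ∀ {n} {f : Rec (suc n)} → Correct f → Correct (min f)
min-correct {f = f} f-correct {rs} {b = b} {k} {σ} rs<b refl (min f⇓0 f⇓suc) =
  let computes run₁ b₁ frame₁ = clear-run b σ
      _ , b₂ , frame₂ , run₂ = go k 0 _ (+-identityʳ k) b₁ frame₁
  in computes (run₁ ⨟ run₂) b₂ frame₂
  where
  C = compile f (b ∷ rs) (1 + b)
  W = while (1 + b) (inc b ⨟ C)
  -- The body of the loop ends with evaluating `f` at the next candidate, so `C ⨟ W` recurs after
  -- each increment of `b`. The number of candidates still to be rejected is `m`.
  go : ∀ m i τ → m + i ≡ k → τ b ≡ i → τ ≗ σ below b → ∃ λ υ → υ b ≡ k × υ ≗ σ below b × (C ⨟ W ⊢ τ ⇒ υ)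
  go m i τ m+i τb frame = step m m+i
    where
    value : ∀ {l} → f [ i ∷ Vec.map σ rs ]⇓ l → Computes C τ (1 + b) l
    value = f-correct (n<1+n b ∷ all-≤ (n≤1+n b) rs<b) (cong₂ _∷_ τb (map-frame rs<b frame))
    step : ∀ m → m + i ≡ k → ∃ λ υ → υ b ≡ k × υ ≗ σ below b × (C ⨟ W ⊢ τ ⇒ υ)
    step zero refl =
      let computes run c frame₁ = value f⇓0
      in _ , trans (frame₁ (n<1+n b)) τb , (λ r<b → trans (frame₁ (m<n⇒m<1+n r<b)) (frame r<b))
         , run ⨟ stop c
    step (suc m) m+i =
      let l , f⇓l = f⇓suc i (subst (i <_) m+i (s≤s (m≤n+m i m)))
          computes {τ₁} run c frame₁ = value f⇓l
          τ₂ = τ₁ [ 1 + b ≔ l ]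
          τ₃ = τ₂ [ b ≔ suc (τ₂ b) ]
          υ , υb , frame₂ , run₂ = go m (suc i) τ₃ (trans (+-suc m i) m+i)
            (trans (update-same τ₂ b) (cong suc (trans (update-other τ₁ 1+n≢n)
               (trans (frame₁ (n<1+n b)) τb))))
            λ r<b → trans (update-other τ₂ (>⇒≢ r<b)) (trans (update-other τ₁ (>⇒≢ (m<n⇒m<1+n r<b)))
               (trans (frame₁ (m<n⇒m<1+n r<b)) (frame r<b)))
      in υ , υb , frame₂ , unroll run c run₂
      where
      unroll : ∀ {τ₁ υ l} → C ⊢ τ ⇒ τ₁ → τ₁ (1 + b) ≡ suc l →
               C ⨟ W ⊢ τ₁ [ 1 + b ≔ l ] [ b ≔ suc ((τ₁ [ 1 + b ≔ l ]) b) ] ⇒ υ → C ⨟ W ⊢ τ ⇒ υ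
      unroll run c (runC ⨟ runW) = run ⨟ loop c (inc ⨟ runC) runW

mutual
  compile-correct : ∀ {n} (f : Rec n) → Correct f
  compile-correct zeroᵣ {b = b} {σ = σ} _ _ zeroᵣ = clear-run b σ
  compile-correct sucᵣ {r ∷ []} {b = b} (r<b ∷ []) refl sucᵣ =
    let computes {τ} run τb frame = copy-run r<b _
    in computes (run ⨟ inc) (trans (update-same τ b) (cong suc τb))
         λ r<b → trans (update-other τ (>⇒≢ r<b)) (frame r<b)
  compile-correct (proj i) {rs} {b = b} {σ = σ} rs<b refl proj =
    subst (Computes _ σ b) (sym (lookup-map i σ rs)) (copy-run (lookup⁺ rs<b i) σ)
  compile-correct (comp {m} f gs) {b = b} {k} {σ} rs<b eq (comp gs⇓ f⇓) =
    let τ , args , frame₁ , run₁ = compile*-correct gs (all-≤ (n≤1+n b) rs<b) eq gs⇓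
        computes run₂ k₂ frame₂ = compile-correct f (registers-< (suc b) m) args f⇓
        drained run₃ b₃ _ others₃ = drain-run b≢1+c _
        drained run₄ _ b₄ others₄ = drain-run c≢b _
    in computes (run₁ (run₂ ⨟ run₃ ⨟ run₄))
         (trans b₄ (trans (cong₂ _+_ (trans (others₃ (≢-sym c≢b) 1+n≢n) k₂) b₃) (+-identityʳ k)))
         λ r<b → let r<c = ≤-trans (m<n⇒m<1+n r<b) (m≤m+n (suc b) m) in
           trans (others₄ (>⇒≢ r<c) (>⇒≢ r<b)) (trans (others₃ (>⇒≢ r<b) (>⇒≢ (m<n⇒m<1+n r<c)))
             (trans (frame₂ r<c) (frame₁ (m<n⇒m<1+n r<b))))
    where
    c≢b : suc b + m ≢ b
    c≢b = >⇒≢ (s≤s (m≤m+n b m))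
    b≢1+c : b ≢ suc (suc b + m)
    b≢1+c = <⇒≢ (m<n⇒m<1+n (s≤s (m≤m+n b m)))
  compile-correct (prim f g) = prim-correct {f = f} {g} (compile-correct f) (compile-correct g)
  compile-correct (min f)    = min-correct (compile-correct f)

  compile*-correct : ∀ {m n} (gs : Vec (Rec n) m) {rs v u b σ} → VecAll.All (_< b) rs → Vec.map σ rs ≡ v →
    gs [ v ]⇓* u → ∃ λ τ → Vec.map τ (registers b m) ≡ u × τ ≗ σ below b ×
      (∀ {Q υ} → Q ⊢ τ ⇒ υ → compile* gs rs b Q ⊢ σ ⇒ υ)
  compile*-correct [] _ _ [] = _ , refl , (λ _ → refl) , id
  compile*-correct (g ∷ gs) {b = b} rs<b refl (g⇓ ∷ gs⇓) =
    let computes run₁ k₁ frame₁ = compile-correct g rs<b refl g⇓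
        τ , args , frame , run₂ = compile*-correct gs (all-≤ (n≤1+n b) rs<b) (map-frame rs<b frame₁) gs⇓
    in τ , cong₂ _∷_ (trans (frame (n<1+n b)) k₁) args
         , (λ r<b → trans (frame (m<n⇒m<1+n r<b)) (frame₁ r<b)) , λ run → run₁ ⨟ run₂ run

-- Counter machines

data Instr : Set where
  up   : ℕ → ℕ → Instr
  down : ℕ → ℕ → ℕ → Instr

Config : Set
Config = ℕ × Store

exec : Instr → Store → Config
exec (up r l)     σ = l , σ [ r ≔ suc (σ r) ]
exec (down r l m) σ with σ r
... | zero  = m , σ
... | suc k = l , σ [ r ≔ k ]

-- Labels beyond the end of the program are infinite loops.
infix 10 _!_

nth : List Instr → ℕ → Maybe Instr
nth []      _       = nothing
nth (i ∷ _) zero    = just i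
nth (_ ∷ c) (suc l) = nth c l

_!_ : List Instr → ℕ → Instr
c ! l = fromMaybe (up 0 l) (nth c l)

step : List Instr → Config → Config
step c (l , σ) = exec (c ! l) σ

steps : List Instr → ℕ → Config → Config
steps c zero    e = e
steps c (suc n) e = steps c n (step c e)

steps-+ : ∀ c m {n e} → steps c (m + n) e ≡ steps c n (steps c m e)
steps-+ c zero    = refl
steps-+ c (suc m) = steps-+ c m

infix 4 _⊩_↝_

_⊩_↝_ : List Instr → Config → Config → Set
c ⊩ e ↝ e′ = ∃ λ n → steps c n e ≡ e′

↝-trans : ∀ {c e e′ e″} → c ⊩ e ↝ e′ → c ⊩ e′ ↝ e″ → c ⊩ e ↝ e″
↝-trans {c} (m , refl) (n , refl) = m + n , steps-+ c m

_⊑_at_ : List Instr → List Instr → ℕ → Set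
[]       ⊑ c at l = ⊤
(i ∷ xs) ⊑ c at l = nth c l ≡ just i × xs ⊑ c at suc l

⊑-++ : ∀ xs {ys c l} → (xs ++ ys) ⊑ c at l → xs ⊑ c at l × ys ⊑ c at (length xs + l)
⊑-++ []       occ        = tt , occ
⊑-++ (_ ∷ xs) {ys} {c} {l} (i , occ) =
  let occ₁ , occ₂ = ⊑-++ xs occ
  in (i , occ₁) , subst (ys ⊑ c at_) (+-suc (length xs) l) occ₂

size : Prog → ℕ
size (inc r)     = 1
size (P ⨟ Q)     = size P + size Q
size (while r P) = suc (size P)

-- flatten P l m is code for P at label l that exits to label m.
flatten : Prog → ℕ → ℕ → List Instr
flatten (inc r)     l m = up r m ∷ []
flatten (P ⨟ Q)     l m = flatten P l (size P + l) ++ flatten Q (size P + l) m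
flatten (while r P) l m = down r (suc l) m ∷ flatten P (suc l) l

length-flatten : ∀ P {l m} → length (flatten P l m) ≡ size P
length-flatten (inc r)     = refl
length-flatten (P ⨟ Q)     = trans (length-++ (flatten P _ _))
                               (cong₂ _+_ (length-flatten P) (length-flatten Q))
length-flatten (while r P) = cong suc (length-flatten P)

flatten-correct : ∀ {P σ τ c l m} → P ⊢ σ ⇒ τ → flatten P l m ⊑ c at l → c ⊩ (l , σ) ↝ (m , τ)
flatten-correct inc (eq , _) = 1 , cong (λ i → exec (fromMaybe _ i) _) eq
flatten-correct {P ⨟ Q} {c = c} {l} {m} (run₁ ⨟ run₂) occ =
  let occ₁ , occ₂ = ⊑-++ (flatten P l (size P + l)) occ
  in ↝-trans (flatten-correct run₁ occ₁)
       (flatten-correct run₂ (subst (λ k → flatten Q (size P + l) m ⊑ c at (k + l)) (length-flatten P) occ₂))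
flatten-correct {σ = σ} (stop σr) (eq , _) = 1 , trans (cong (λ i → exec (fromMaybe _ i) _) eq) (exec-zero σr)
  where
  exec-zero : ∀ {r l m} → σ r ≡ 0 → exec (down r l m) σ ≡ (m , σ)
  exec-zero σr rewrite σr = refl
flatten-correct {σ = σ} (loop σr run₁ run₂) occ@(eq , occ₁) =
  ↝-trans (1 , trans (cong (λ i → exec (fromMaybe _ i) _) eq) (exec-suc σr))
    (↝-trans (flatten-correct run₁ occ₁) (flatten-correct run₂ occ))
  where
  exec-suc : ∀ {r l m k} → σ r ≡ suc k → exec (down r l m) σ ≡ (l , σ [ r ≔ k ])
  exec-suc σr rewrite σr = refl

⊑-∷ : ∀ xs {i c l} → xs ⊑ c at l → xs ⊑ (i ∷ c) at suc l
⊑-∷ []       _          = tt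
⊑-∷ (_ ∷ xs) (eq , occ) = eq , ⊑-∷ xs occ

⊑-refl : ∀ c → c ⊑ c at 0
⊑-refl []      = tt
⊑-refl (_ ∷ c) = refl , ⊑-∷ c (⊑-refl c)

loop-forever : ∀ {c l} → c ! l ≡ up 0 l → ∀ n {σ} → proj₁ (steps c n (l , σ)) ≡ l
loop-forever eq zero    = refl
loop-forever {c} {l} eq (suc n) {σ} =
  trans (cong (λ i → proj₁ (steps c n (exec i σ))) eq) (loop-forever eq n)

module Machine (F : Rec 2) where

  main : Prog
  main = compile F (0 ∷ 1 ∷ []) 2

  idle halt : ℕ
  idle = 1 + size main
  halt = 2 + size main

  -- Value 0 leads to `halt` and any other value to `idle`. Both are infinite loops, so runs never
  -- end, and halting means visiting a label.
  tail : List Instr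
  tail = down 2 idle halt ∷ up 0 idle ∷ up 0 halt ∷ []

  program : List Instr
  program = flatten main 0 (size main) ++ tail

  private
    occurs : flatten main 0 (size main) ⊑ program at 0 × tail ⊑ program at size main
    occurs =
      let occ₁ , occ₂ = ⊑-++ (flatten main 0 (size main)) (⊑-refl program)
      in occ₁ , subst (tail ⊑ program at_) (trans (+-identityʳ _) (length-flatten main)) occ₂

  program-length : length program ≡ suc halt
  program-length = trans (length-++ (flatten main 0 _))
    (trans (cong (_+ 3) (length-flatten main)) (+-comm (size main) 3))

  idle-loop : program ! idle ≡ up 0 idle
  idle-loop = cong (fromMaybe _) (proj₁ (proj₂ (proj₂ occurs)))

  halt-loop : program ! halt ≡ up 0 halt
  halt-loop = cong (fromMaybe _) (proj₁ (proj₂ (proj₂ (proj₂ occurs))))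

  module _ {m n : ℕ} {σ : Store} (σ0 : σ 0 ≡ m) (σ1 : σ 1 ≡ n) where

    private
      reaches : ∀ {k} → F [ m ∷ n ∷ [] ]⇓ k → ∃ λ τ → τ 2 ≡ k ×
                program ⊩ (0 , σ) ↝ exec (down 2 idle halt) τ
      reaches F⇓ =
        let computes {τ} run τ2 _ = compile-correct F {b = 2} (s≤s z≤n ∷ s≤s (s≤s z≤n) ∷ [])
              (cong₂ (λ k l → k ∷ l ∷ []) σ0 σ1) F⇓
        in τ , τ2 , ↝-trans (flatten-correct run (proj₁ occurs))
             (1 , cong (λ i → exec (fromMaybe (up 0 (size main)) i) τ) (proj₁ (proj₂ occurs)))

    halts : F [ m ∷ n ∷ [] ]⇓ 0 → ∃ λ k → proj₁ (steps program k (0 , σ)) ≡ halt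
    halts F⇓ with reaches F⇓
    ... | τ , τ2 , k , eq = k , trans (cong proj₁ eq) (exec-zero τ2)
      where
      exec-zero : τ 2 ≡ 0 → proj₁ (exec (down 2 idle halt) τ) ≡ halt
      exec-zero eq rewrite eq = refl

    -- Neither `halt` nor `idle` is ever left. If they were visited at times `k` and `l`, the run
    -- would be at both of them at time `k + l`.
    diverges : ∀ {a} → F [ m ∷ n ∷ [] ]⇓ suc a → ∀ k → proj₁ (steps program k (0 , σ)) ≢ halt
    diverges F⇓ k halted with reaches F⇓
    ... | τ , τ2 , l , eq = 1+n≢n (trans (sym at-halt) at-idle)
      where
      exec-suc : ∀ {a} → τ 2 ≡ suc a → proj₁ (exec (down 2 idle halt) τ) ≡ idle
      exec-suc eq rewrite eq = refl
      stays : ∀ {j i} k l → program ! j ≡ up 0 j → proj₁ (steps program k (0 , σ)) ≡ j →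
              k + l ≡ i → proj₁ (steps program i (0 , σ)) ≡ j
      stays k l loops refl refl = trans (cong proj₁ (steps-+ program k)) (loop-forever loops l)
      at-halt : proj₁ (steps program (k + l) (0 , σ)) ≡ halt
      at-halt = stays k l halt-loop halted refl
      at-idle : proj₁ (steps program (k + l) (0 , σ)) ≡ idle
      at-idle = stays l k idle-loop (trans (cong proj₁ eq) (exec-suc τ2)) (+-comm l k)

-- Runs of the machine as sequences of moves

-- The list has no repetitions and misses nothing, so its length is the cardinality of `P`.
-- Shrinking the predicate along the list avoids any decidability of `P`.
Enumerates : (ℕ → Set) → List ℕ → Set
Enumerates P []       = ∀ q → ¬ P q
Enumerates P (p ∷ ps) = P p × Enumerates (λ q → P q × q ≢ p) ps

enumerates-cong : ∀ {P Q} ps → (∀ {q} → P q → Q q) → (∀ {q} → Q q → P q) →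
                  Enumerates P ps → Enumerates Q ps
enumerates-cong []       to from none        = λ q → none q ∘ from
enumerates-cong (p ∷ ps) to from (Pp , rest) =
  to Pp , enumerates-cong ps (λ (Pq , ≢p) → to Pq , ≢p) (λ (Qq , ≢p) → from Qq , ≢p) rest

remove : ∀ {P p} ps → Enumerates P ps → P p →
         ∃ λ qs → length ps ≡ suc (length qs) × Enumerates (λ q → P q × q ≢ p) qs
remove         []       none        Pp = ⊥-elim (none _ Pp)
remove {p = p} (q ∷ ps) (Pq , rest) Pp with p ≟ q
... | yes refl = ps , refl , rest
... | no p≢q   =
  let qs , eq , rest′ = remove ps rest (Pp , p≢q)
  in q ∷ qs , cong suc eq , (Pq , ≢-sym p≢q) ,
     enumerates-cong qs (λ ((Pr , ≢q) , ≢p) → (Pr , ≢p) , ≢q) (λ ((Pr , ≢p) , ≢q) → (Pr , ≢q) , ≢p) rest′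

data Ups (r : ℕ) : Instr → Set where
  up : ∀ {l} → Ups r (up r l)

data Match : Instr → Instr → Set where
  match : ∀ {r l l′ m′} → Match (up r l) (down r l′ m′)

ups? : ∀ r i → Dec (Ups r i)
ups? r (up r′ _) with r ≟ r′
... | yes refl = yes up
... | no r≢r′  = no λ { up → r≢r′ refl }
ups? r (down _ _ _) = no λ ()

match? : ∀ i j → Dec (Match i j)
match? _          (up _ _)      = no λ ()
match? (up r l) (down r′ _ _) with r ≟ r′
... | yes refl = yes match
... | no r≢r′  = no λ { match → r≢r′ refl }
match? (down _ _ _) (down _ _ _) = no λ ()

match-ups : ∀ {i r l m} → Match i (down r l m) → Ups r i
match-ups match = up

ups-match : ∀ {i r l m} → Ups r i → Match i (down r l m)
ups-match up = match

ups-unique : ∀ {i r r′} → Ups r i → Ups r′ i → r ≡ r′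
ups-unique up up = refl

-- A run of System is a sequence of pairs of a letter pc t and a process
-- proc t.  An increment is played on a fresh process, and a decrement on
-- the process of an earlier increment of the same register; a process
-- with an increment and no decrement is live.  A failed test for
-- positivity is a decrement played on a fresh process.
module Trace (op : ℕ → Instr) (pc proc : ℕ → ℕ) where

  Used : ℕ → Set
  Used t = ∃ λ j → j < t × proc j ≡ proc t

  used? : ∀ t → Dec (Used t)
  used? t = anyUpTo? (λ j → proc j ≟ proc t) t

  Live : ℕ → ℕ → ℕ → Set
  Live t r q = ∃ λ j → j < t × Ups r (op (pc j)) × proc j ≡ q ×
               (∀ k → j < k → k < t → proc k ≢ q)

  -- No instruction can be both the second component of one `Match` and the first of another.
  -- Required at all times, this leaves at most two moves per process: an increment, then a
  -- decrement of the same register.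
  Matched : ℕ → Set
  Matched t = ∀ j → j < t → proc j ≡ proc t → Match (op (pc j)) (op (pc t))

  -- The formula can only require the later move to be active, hence the bound `k ≤ t`; the case
  -- `k = t` is ruled out by `¬ Used t`. The double negation is that of `∃x`.
  ZeroTest : ℕ → Instr → Set
  ZeroTest t (up _ _)     = ⊤
  ZeroTest t (down r _ _) = ¬ Used t → ∀ j → j < t → Ups r (op (pc j)) →
                            ¬ ¬ (∃ λ k → k ≤ t × j < k × proc j ≡ proc k)

  Next : ℕ → Instr → Set
  Next t (up _ l)     = pc (suc t) ≡ 2 + l
  Next t (down _ l m) = (Used t → pc (suc t) ≡ 2 + l) × (¬ Used t → pc (suc t) ≡ 2 + m)

  live-used : ∀ {t r} → Live t r (proc t) → Used t
  live-used (j , j<t , _ , eq , _) = j , j<t , eq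

  live-keep : ∀ {t r q} → Live t r q → q ≢ proc t → Live (suc t) r q
  live-keep {t} (j , j<t , ups , eq , last) q≢ = j , m<n⇒m<1+n j<t , ups , eq , λ k j<k k<1+t →
    case-k k j<k (m<1+n⇒m<n∨m≡n k<1+t)
    where
    case-k : ∀ k → j < k → k < t ⊎ k ≡ t → proc k ≢ _
    case-k k j<k (inj₁ k<t)  = last k j<k k<t
    case-k k j<k (inj₂ refl) = ≢-sym q≢

  live-suc : ∀ {t r q} → Live (suc t) r q →
             (q ≡ proc t × Ups r (op (pc t))) ⊎ (Live t r q × q ≢ proc t)
  live-suc (j , j<1+t , ups , eq , last) with m<1+n⇒m<n∨m≡n j<1+t
  ... | inj₂ refl = inj₁ (sym eq , ups)
  ... | inj₁ j<t  = inj₂ ((j , j<t , ups , eq , λ k j<k k<t → last k j<k (m<n⇒m<1+n k<t)) ,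
                          ≢-sym (last _ j<t (n<1+n _)))

  push : ∀ {t r} ps → Ups r (op (pc t)) → ¬ Live t r (proc t) →
         Enumerates (Live t r) ps → Enumerates (Live (suc t) r) (proc t ∷ ps)
  push {t} ps ups ¬live enum =
    (t , n<1+n t , ups , refl , λ k t<k k<1+t → ⊥-elim (<⇒≱ t<k (≤-pred k<1+t))) ,
    enumerates-cong ps (λ live → live-keep live (≢proc live) , ≢proc live)
      (λ (live , q≢) → old q≢ (live-suc live)) enum
    where
    ≢proc : ∀ {q} → Live t _ q → q ≢ proc t
    ≢proc live refl = ¬live live
    old : ∀ {q A B} → q ≢ proc t → (q ≡ proc t × A) ⊎ (B × q ≢ proc t) → B
    old q≢ (inj₁ (eq , _))   = ⊥-elim (q≢ eq)
    old q≢ (inj₂ (live , _)) = live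

  pop : ∀ {t r} ps → ¬ Ups r (op (pc t)) →
        Enumerates (λ q → Live t r q × q ≢ proc t) ps → Enumerates (Live (suc t) r) ps
  pop ps ¬ups = enumerates-cong ps (λ (live , q≢) → live-keep live q≢) (λ live → old (live-suc live))
    where
    old : ∀ {A B : Set} → (A × Ups _ _) ⊎ B → B
    old (inj₁ (_ , ups)) = ⊥-elim (¬ups ups)
    old (inj₂ live)      = live

  keep : ∀ {t r} ps → ¬ Ups r (op (pc t)) → ¬ Live t r (proc t) →
         Enumerates (Live t r) ps → Enumerates (Live (suc t) r) ps
  keep ps ¬ups ¬live enum = pop ps ¬ups
    (enumerates-cong ps (λ live → live , λ { refl → ¬live live }) proj₁ enum)

  Counts : ℕ → Store → Set
  Counts t σ = ∀ r → ∃ λ ps → length ps ≡ σ r × Enumerates (Live t r) ps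

  -- The content of a register is the number of its live processes. A decrement on a used process
  -- has a live one, so the register is positive; on a fresh process, the zero test leaves no live
  -- one, so the register is zero. Thus the branch that System takes is that of the machine.
  advance : ∀ {t σ} → (∀ j → j ≤ t → Matched j) → ZeroTest t (op (pc t)) → Counts t σ →
            let e = exec (op (pc t)) σ in
            Counts (suc t) (proj₂ e) × (Next t (op (pc t)) → pc (suc t) ≡ 2 + proj₁ e)
  advance {t} {σ} matched zero-test counts with op (pc t) in op≡
  ... | up r l = counts′ , id
    where
    unused : ¬ Used t
    unused (j , j<t , eq) with subst (Match _) op≡ (matched t ≤-refl j j<t eq)
    ... | ()
    counts′ : Counts (suc t) (σ [ r ≔ suc (σ r) ])
    counts′ r′ with r ≟ r′ | counts r′
    ... | yes refl | ps , eq , enum =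
      proc t ∷ ps , cong suc eq , push ps (subst (Ups r) (sym op≡) up) (unused ∘ live-used) enum
    ... | no r≢r′  | ps , eq , enum =
      ps , eq , keep ps (λ ups → r≢r′ (ups-unique up (subst (Ups r′) op≡ ups))) (unused ∘ live-used) enum
  ... | down r l m with used? t
  ...   | yes used@(j , j<t , eq) = result
    where
    live : Live t r (proc t)
    live = j , j<t , match-ups (subst (Match _) op≡ (matched t ≤-refl j j<t eq)) , eq , λ k j<k k<t eq′ →
      contra (matched k (<⇒≤ k<t) j j<k (trans eq (sym eq′))) (matched t ≤-refl k k<t eq′)
      where
      contra : ∀ {i i′ i″} → Match i i′ → Match i′ i″ → ⊥
      contra match ()
    no-ups : ∀ {r′} → ¬ Ups r′ (op (pc t))
    no-ups ups with subst (Ups _) op≡ ups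
    ... | ()
    result : let e = exec (down r l m) σ in
             Counts (suc t) (proj₂ e) × (Next t (down r l m) → pc (suc t) ≡ 2 + proj₁ e)
    result with σ r | counts r
    ... | n | ps , len , enum with remove ps enum live
    ...   | qs , len′ , enum′ with trans (sym len) len′
    ...     | refl = counts′ , λ (yes-used , _) → yes-used used
      where
      counts′ : Counts (suc t) (σ [ r ≔ length qs ])
      counts′ r′ with r ≟ r′ | counts r′
      ... | yes refl | _ = qs , refl , pop qs no-ups enum′
      ... | no r≢r′  | ps , eq , enum = ps , eq , keep ps no-ups
        (λ (j′ , j′<t , ups , eq′ , _) → r≢r′ (ups-unique
          (match-ups (subst (Match _) op≡ (matched t ≤-refl j′ j′<t eq′))) ups)) enum
  ...   | no unused = result
    where
    result : let e = exec (down r l m) σ in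
             Counts (suc t) (proj₂ e) × (Next t (down r l m) → pc (suc t) ≡ 2 + proj₁ e)
    result with σ r | counts r
    ... | n | q ∷ _ , _ , (j , j<t , ups , eq , last) , _ = ⊥-elim (zero-test unused j j<t ups later)
      where
      later : ¬ (∃ λ k → k ≤ t × j < k × proc j ≡ proc k)
      later (k , k≤t , j<k , eq′) with m≤n⇒m<n∨m≡n k≤t
      ... | inj₁ k<t  = last k j<k k<t (trans (sym eq′) eq)
      ... | inj₂ refl = unused (j , j<k , eq′)
    ... | zero | [] , _ , _ = counts′ , λ (_ , no-used) → no-used unused
      where
      counts′ : Counts (suc t) σ
      counts′ r′ with counts r′
      ... | ps , eq , enum = ps , eq , keep ps no-ups (unused ∘ live-used) enum
        where
        no-ups : ¬ Ups r′ (op (pc t))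
        no-ups ups with subst (Ups _) op≡ ups
        ... | ()

-- Letters 0 and 1 load the registers 0 and 1, and letter 2 + l stands
-- for the label l of the program.
letterOp : List Instr → ℕ → Instr
letterOp c 0             = up 0 0
letterOp c 1             = up 1 0
letterOp c (suc (suc l)) = c ! l

-- The machine c with inputs m and n, where the first m + n steps load
-- the inputs.
module Loaded (c : List Instr) (m n : ℕ) where

  op : ℕ → Instr
  op = letterOp c

  data Phase (t : ℕ) : Set where
    load₀   : t < m → Phase t
    load₁   : m ≤ t → t < m + n → Phase t
    start   : t ≡ m + n → Phase t
    running : m + n < t → Phase t

  phase : ∀ t → Phase t
  phase t with t <? m | <-cmp t (m + n)
  ... | yes t<m | _              = load₀ t<m
  ... | no t≮m  | tri< t<m+n _ _ = load₁ (≮⇒≥ t≮m) t<m+n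
  ... | no _    | tri≈ _ t≡m+n _ = start t≡m+n
  ... | no _    | tri> _ _ t>m+n = running t>m+n

  -- Up to time `m + n` the letter is dictated by the time, whatever the last instruction jumps to;
  -- only afterwards do jumps count.
  force : ∀ {t} → Phase t → ℕ → ℕ
  force (load₀ _)   _ = 0
  force (load₁ _ _) _ = 1
  force (start _)   _ = 2
  force (running _) l = l

  config : ℕ → Config
  config zero    = force (phase 0) 0 , λ _ → 0
  config (suc t) =
    let l , σ = exec (op (proj₁ (config t))) (proj₂ (config t))
    in force (phase (suc t)) (2 + l) , σ

  PC : ℕ → ℕ
  PC = proj₁ ∘ config

  store : ℕ → Store
  store = proj₂ ∘ config

  force-load₀ : ∀ {t} (ph : Phase t) {l} → t < m → force ph l ≡ 0
  force-load₀ (load₀ _)    t<m = refl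
  force-load₀ (load₁ m≤t _) t<m = ⊥-elim (<⇒≱ t<m m≤t)
  force-load₀ (start refl) t<m = ⊥-elim (<⇒≱ t<m (m≤m+n m n))
  force-load₀ (running m+n<t) t<m = ⊥-elim (<⇒≱ t<m (≤-trans (m≤m+n m n) (<⇒≤ m+n<t)))

  force-load₁ : ∀ {t} (ph : Phase t) {l} → m ≤ t → t < m + n → force ph l ≡ 1
  force-load₁ (load₀ t<m)  m≤t t<m+n = ⊥-elim (<⇒≱ t<m m≤t)
  force-load₁ (load₁ _ _)  m≤t t<m+n = refl
  force-load₁ (start refl) m≤t t<m+n = ⊥-elim (<-irrefl refl t<m+n)
  force-load₁ (running m+n<t) m≤t t<m+n = ⊥-elim (<-asym m+n<t t<m+n)

  force-start : ∀ {t} (ph : Phase t) {l} → t ≡ m + n → force ph l ≡ 2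
  force-start (load₀ t<m)     refl = ⊥-elim (<⇒≱ t<m (m≤m+n m n))
  force-start (load₁ _ t<m+n) refl = ⊥-elim (<-irrefl refl t<m+n)
  force-start (start _)       refl = refl
  force-start (running m+n<t) refl = ⊥-elim (<-irrefl refl m+n<t)

  force-running : ∀ {t} (ph : Phase t) {l} → m + n < t → force ph l ≡ l
  force-running (load₀ t<m)     m+n<t = ⊥-elim (<⇒≱ t<m (≤-trans (m≤m+n m n) (<⇒≤ m+n<t)))
  force-running (load₁ _ t<m+n) m+n<t = ⊥-elim (<-asym m+n<t t<m+n)
  force-running (start refl)    m+n<t = ⊥-elim (<-irrefl refl m+n<t)
  force-running (running _)     m+n<t = refl

  PC-force : ∀ t → ∃ λ l → PC t ≡ force (phase t) l
  PC-force zero    = _ , refl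
  PC-force (suc t) = _ , refl

  PC-load₀ : ∀ {t} → t < m → PC t ≡ 0
  PC-load₀ {t} t<m = trans (proj₂ (PC-force t)) (force-load₀ (phase t) t<m)

  PC-load₁ : ∀ {t} → m ≤ t → t < m + n → PC t ≡ 1
  PC-load₁ {t} m≤t t<m+n = trans (proj₂ (PC-force t)) (force-load₁ (phase t) m≤t t<m+n)

  PC-start : PC (m + n) ≡ 2
  PC-start = trans (proj₂ (PC-force (m + n))) (force-start (phase (m + n)) refl)

  store-load₀ : ∀ {t} → t ≤ m → store t 0 ≡ t × store t 1 ≡ 0
  store-load₀ {zero}  _   = refl , refl
  store-load₀ {suc t} t<m =
    let eq₀ , eq₁ = store-load₀ (<⇒≤ t<m)
        eq : store (suc t) ≡ store t [ 0 ≔ suc (store t 0) ]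
        eq = cong (λ l → proj₂ (exec (op l) (store t))) (PC-load₀ t<m)
    in trans (cong-app eq 0) (cong suc eq₀) , trans (cong-app eq 1) eq₁

  store-load₁ : ∀ {t} → t ≤ n → store (t + m) 0 ≡ m × store (t + m) 1 ≡ t
  store-load₁ {zero}  _   = store-load₀ ≤-refl
  store-load₁ {suc t} t<n =
    let eq₀ , eq₁ = store-load₁ (<⇒≤ t<n)
        eq : store (suc t + m) ≡ store (t + m) [ 1 ≔ suc (store (t + m) 1) ]
        eq = cong (λ l → proj₂ (exec (op l) (store (t + m))))
               (PC-load₁ (m≤n+m m t) (subst (t + m <_) (+-comm n m) (+-monoˡ-< m t<n)))
    in trans (cong-app eq 0) eq₀ , trans (cong-app eq 1) (cong suc eq₁)

  σ₀ : Store
  σ₀ = store (m + n)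

  σ₀-0 : σ₀ 0 ≡ m
  σ₀-0 = subst (λ t → store t 0 ≡ m) (+-comm n m) (proj₁ (store-load₁ ≤-refl))

  σ₀-1 : σ₀ 1 ≡ n
  σ₀-1 = subst (λ t → store t 1 ≡ n) (+-comm n m) (proj₂ (store-load₁ ≤-refl))

  config-steps : ∀ k → let l , σ = steps c k (0 , σ₀) in config (k + (m + n)) ≡ (2 + l , σ)
  config-steps zero    = cong (_, σ₀) PC-start
  config-steps (suc k) =
    trans (cong₂ _,_ (force-running (phase (suc k + (m + n))) (s≤s (m≤n+m (m + n) k))) refl)
      (trans (cong (λ (l , σ) → let l′ , σ′ = exec (op l) σ in 2 + l′ , σ′) (config-steps k))
        (cong (λ (l , σ) → 2 + l , σ) (trans (sym (steps-+ c k)) (cong (λ i → steps c i (0 , σ₀)) (+-comm k 1)))))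

  2≤PC : ∀ {t} → m + n ≤ t → 2 ≤ PC t
  2≤PC {t} m+n≤t =
    subst (λ t → 2 ≤ PC t) (m∸n+n≡m m+n≤t)
      (subst (2 ≤_) (sym (cong proj₁ (config-steps (t ∸ (m + n))))) (s≤s (s≤s z≤n)))

  PC-next : ∀ {t} → m + n ≤ t → PC (suc t) ≡ 2 + proj₁ (exec (op (PC t)) (store t))
  PC-next {t} m+n≤t = force-running (phase (suc t)) (s≤s m+n≤t)

  PC-halts : ∀ {h} → (∃ λ k → proj₁ (steps c k (0 , σ₀)) ≡ h) → ∃ λ t → PC t ≡ 2 + h
  PC-halts (k , eq) = k + (m + n) , trans (cong proj₁ (config-steps k)) (cong (2 +_) eq)

  PC-diverges : ∀ {h} → (∀ k → proj₁ (steps c k (0 , σ₀)) ≢ h) → ∀ t → PC t ≢ 2 + h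
  PC-diverges ≢h t eq with phase t
  ... | load₀ t<m = 0≢1+n (trans (sym (PC-load₀ t<m)) eq)
  ... | load₁ m≤t t<m+n = 0≢1+n (cong pred (trans (sym (PC-load₁ m≤t t<m+n)) eq))
  ... | start refl = ≢h 0 (cong (pred ∘ pred) (trans (sym PC-start) eq))
  ... | running m+n<t = ≢h (t ∸ (m + n)) (cong (pred ∘ pred) (trans
          (sym (trans (cong PC (sym (m∸n+n≡m (<⇒≤ m+n<t)))) (cong proj₁ (config-steps (t ∸ (m + n)))))) eq))

  nth-beyond : ∀ c {l} → length c ≤ l → nth c l ≡ nothing
  nth-beyond []      _         = refl
  nth-beyond (_ ∷ c) (s≤s len) = nth-beyond c len

  -- Control never returns from a label beyond the end of the program.
  PC-bounded : ∀ {h τ} → h < length c → PC τ ≡ 2 + h → ∀ {t} → t ≤ τ → PC t < 2 + length c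
  PC-bounded {h} {τ} h<c eq {t} t≤τ with PC t <? 2 + length c
  ... | yes PC<    = PC<
  ... | no  PC≮    =
    ⊥-elim (<⇒≱ (subst (_< 2 + length c) h≡PC (s≤s (s≤s h<c))) (≮⇒≥ PC≮))
    where
    late : m + n ≤ t
    late with phase t
    ... | load₀ t<m = ⊥-elim (PC≮ (subst (_< 2 + length c) (sym (PC-load₀ t<m)) (s≤s z≤n)))
    ... | load₁ m≤t t<m+n = ⊥-elim (PC≮ (subst (_< 2 + length c) (sym (PC-load₁ m≤t t<m+n)) (s≤s (s≤s z≤n))))
    ... | start refl = ≤-refl
    ... | running m+n<t = <⇒≤ m+n<t
    idles : ∀ {l σ} → 2 + length c ≤ l → 2 + proj₁ (exec (op l) σ) ≡ l
    idles {suc (suc l)} (s≤s (s≤s len)) rewrite nth-beyond c len = refl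
    stuck : ∀ k → PC (k + t) ≡ PC t
    stuck zero    = refl
    stuck (suc k) = trans (PC-next (≤-trans late (m≤n+m t k)))
      (trans (idles (subst (2 + length c ≤_) (sym (stuck k)) (≮⇒≥ PC≮))) (stuck k))
    h≡PC : 2 + h ≡ PC t
    h≡PC = trans (sym eq) (trans (cong PC (sym (m∸n+n≡m t≤τ))) (stuck (τ ∸ t)))

  -- This is what the sentence says about the prefix of length `k`; `zero-test` and `next` concern
  -- its end only. The condition `2 ≤ pc t` exempts the loading letters, whose successors depend on
  -- the time.
  record Good (pc proc : ℕ → ℕ) (k : ℕ) : Set where
    open Trace op pc proc
    field
      pc-load₀  : ∀ t → t < k → t < m → pc t ≡ 0
      pc-load₁  : ∀ t → t < k → m ≤ t → t < m + n → pc t ≡ 1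
      pc-start  : m + n < k → pc (m + n) ≡ 2
      matched   : ∀ t → t < k → Matched t
      zero-test : ∀ t → suc t ≡ k → ZeroTest t (op (pc t))
      next      : ∀ t → suc (suc t) ≡ k → 2 ≤ pc t → Next t (op (pc t))

  module _ {pc proc : ℕ → ℕ} where

    open Trace op pc proc
    open Good

    -- The labels and the register contents are tracked by a simultaneous induction. The zero test
    -- at `t` comes from the prefix of length `suc t`, and the jump out of `t` from the prefix of
    -- length `2 + t`.
    tracks : ∀ {k} → (∀ j → j ≤ k → Good pc proc j) →
             ∀ t → t < k → pc t ≡ PC t × Counts t (store t)
    tracks {k} good t t<k = pc≡PC t t<k , counts t (<⇒≤ t<k)
      where
      pc≡PC : ∀ t → t < k → pc t ≡ PC t
      counts : ∀ t → t ≤ k → Counts t (store t)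
      advance′ : ∀ t → t < k → let e = exec (op (PC t)) (store t) in
            Counts (suc t) (proj₂ e) × (Next t (op (pc t)) → pc (suc t) ≡ 2 + proj₁ e)
      advance′ t t<k rewrite sym (pc≡PC t t<k) =
        advance (λ j j≤t → matched (good k ≤-refl) j (≤-trans (s≤s j≤t) t<k))
          (zero-test (good (suc t) t<k) t refl) (counts t (<⇒≤ t<k))
      counts zero    _   = λ r → [] , refl , λ { _ (_ , () , _) }
      counts (suc t) t<k = proj₁ (advance′ t t<k)
      pc≡PC t t<k with phase t
      ... | load₀ t<m = trans (pc-load₀ (good k ≤-refl) t t<k t<m) (sym (PC-load₀ t<m))
      ... | load₁ m≤t t<m+n = trans (pc-load₁ (good k ≤-refl) t t<k m≤t t<m+n) (sym (PC-load₁ m≤t t<m+n))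
      ... | start refl = trans (pc-start (good k ≤-refl) t<k) (sym PC-start)
      pc≡PC (suc t) t<k | running (s≤s m+n≤t) =
        trans (proj₂ (advance′ t (<⇒≤ t<k)) (next (good (2 + t) t<k) t refl
          (subst (2 ≤_) (sym (pc≡PC t (<⇒≤ t<k))) (2≤PC m+n≤t)))) (sym (PC-next m+n≤t))

  -- System decrements a register on the process of its latest live
  -- increment.  In the other cases the move at time t is on process t.
  after : Instr → ℕ → (ℕ → List ℕ) → ℕ → List ℕ
  after (up r _)     t s = s [ r ≔ t ∷ s r ]
  after (down r _ _) t s = s [ r ≔ drop 1 (s r) ]

  stacks : ℕ → ℕ → List ℕ
  stacks zero    r = []
  stacks (suc t) = after (op (PC t)) t (stacks t)

  player : Instr → ℕ → (ℕ → List ℕ) → ℕ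
  player (up _ _)     t s = t
  player (down r _ _) t s = fromMaybe t (head (s r))

  Proc : ℕ → ℕ
  Proc t = player (op (PC t)) t (stacks t)

  open Trace op PC Proc

  stacks-< : ∀ t r → ListAll.All (_< t) (stacks t r)
  stacks-< zero    r = []
  stacks-< (suc t) r = after-< (op (PC t)) (λ r → ListAll.map m<n⇒m<1+n (stacks-< t r))
    where
    after-< : ∀ i {s} → (∀ r → ListAll.All (_< suc t) (s r)) → ListAll.All (_< suc t) (after i t s r)
    after-< (up r′ _)     s<t with r′ ≟ r
    ... | yes _ = n<1+n t ∷ s<t r′
    ... | no  _ = s<t r
    after-< (down r′ _ _) s<t with r′ ≟ r
    ... | yes _ = drop⁺ 1 (s<t r′)
    ... | no  _ = s<t r

  Proc-≤ : ∀ t → Proc t ≤ t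
  Proc-≤ t = player-≤ (op (PC t)) (stacks-< t)
    where
    player-≤ : ∀ i {s} → (∀ r → ListAll.All (_< t) (s r)) → player i t s ≤ t
    player-≤ (up _ _)     s<t = ≤-refl
    player-≤ (down r _ _) {s} s<t with s r | s<t r
    ... | []    | _       = ≤-refl
    ... | _ ∷ _ | p<t ∷ _ = <⇒≤ p<t

  Proc-up : ∀ {t r} → Ups r (op (PC t)) → Proc t ≡ t
  Proc-up {t} ups with op (PC t) | ups
  ... | _ | up = refl

  -- By `Proc-≤`, a move at an earlier time `j` is on a process numbered at most `j`.
  fresh : ∀ {t} → Proc t ≡ t → ¬ Used t
  fresh Pt (j , j<t , eq) = <⇒≱ j<t (subst (_≤ j) (trans eq Pt) (Proc-≤ j))

  Stacked : ℕ → Set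
  Stacked t = ∀ r → length (stacks t r) ≡ store t r × Enumerates (Live t r) (stacks t r)

  record Stage (t : ℕ) : Set where
    field
      is-matched : Matched t
      zero-test  : ZeroTest t (op (PC t))
      next       : m + n ≤ t → Next t (op (PC t))
      stacked    : Stacked (suc t)

  StackedBy : ℕ → Instr → Set
  StackedBy t i = ∀ r → length (after i t (stacks t) r) ≡ proj₂ (exec i (store t)) r ×
                  Enumerates (Live (suc t) r) (after i t (stacks t) r)

  module _ {t : ℕ} (stk : Stacked t) where

    stage-up : ∀ {r l} → op (PC t) ≡ up r l → Stage t
    stage-up {r} {l} op≡ = record
      { is-matched = λ j j<t eq → ⊥-elim (unused (j , j<t , eq))
      ; zero-test  = subst (ZeroTest t) (sym op≡) tt
      ; next       = λ m+n≤t → subst (Next t) (sym op≡)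
                       (trans (PC-next m+n≤t) (cong (λ i → 2 + proj₁ (exec i (store t))) op≡))
      ; stacked    = subst (StackedBy t) (sym op≡) stacked
      }
      where
      Proc≡ : Proc t ≡ t
      Proc≡ = cong (λ i → player i t (stacks t)) op≡
      unused : ¬ Used t
      unused = fresh Proc≡
      stacked : StackedBy t (up r l)
      stacked r′ with r ≟ r′ | stk r′
      ... | yes refl | len , enum = cong suc len ,
        subst (λ q → Enumerates (Live (suc t) r) (q ∷ stacks t r)) Proc≡
          (push _ (subst (Ups r) (sym op≡) up) (unused ∘ live-used) enum)
      ... | no r≢r′  | len , enum = len ,
        keep _ (λ ups → r≢r′ (ups-unique up (subst (Ups r′) op≡ ups))) (unused ∘ live-used) enum

    module _ {r l l′ : ℕ} (op≡ : op (PC t) ≡ down r l l′) where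

      no-ups : ∀ {r′} → ¬ Ups r′ (op (PC t))
      no-ups ups with subst (Ups _) op≡ ups
      ... | ()

      Proc-down : ∀ {ps} → stacks t r ≡ ps → Proc t ≡ fromMaybe t (head ps)
      Proc-down eq = trans (cong (λ i → player i t (stacks t)) op≡) (cong (fromMaybe t ∘ head) eq)

      stage-zero : stacks t r ≡ [] → Stage t
      stage-zero empty = record
        { is-matched = λ j j<t eq → ⊥-elim (unused (j , j<t , eq))
        ; zero-test  = subst (ZeroTest t) (sym op≡) λ _ j j<t ups unmatched →
            subst (Enumerates (Live t r)) empty (proj₂ (stk r)) (Proc j)
              (j , j<t , ups , refl , λ k j<k k<t eq → unmatched (k , <⇒≤ k<t , j<k , sym eq))
        ; next       = λ m+n≤t → subst (Next t) (sym op≡)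
            ((λ used → ⊥-elim (unused used)) , λ _ → trans (PC-next m+n≤t) (cong (2 +_) (trans
               (cong (λ i → proj₁ (exec i (store t))) op≡) label)))
        ; stacked    = subst (StackedBy t) (sym op≡) stacked
        }
        where
        unused : ¬ Used t
        unused = fresh (Proc-down empty)
        store≡0 : store t r ≡ 0
        store≡0 = trans (sym (proj₁ (stk r))) (cong length empty)
        label : proj₁ (exec (down r l l′) (store t)) ≡ l′
        label rewrite store≡0 = refl
        stacked : StackedBy t (down r l l′)
        stacked r′ rewrite store≡0 with r ≟ r′ | stk r′
        ... | yes refl | len , enum rewrite empty = len , keep _ no-ups (unused ∘ live-used) enum
        ... | no _     | len , enum = len , keep _ no-ups (unused ∘ live-used) enum

      stage-positive : ∀ {p ps} → stacks t r ≡ p ∷ ps → Stage t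
      stage-positive {p} {ps} eq = record
        { is-matched = is-matched
        ; zero-test  = subst (ZeroTest t) (sym op≡) λ ¬used → ⊥-elim (¬used used)
        ; next       = λ m+n≤t → subst (Next t) (sym op≡)
            ((λ _ → trans (PC-next m+n≤t) (cong (2 +_) (trans
               (cong (λ i → proj₁ (exec i (store t))) op≡) label))) , λ ¬used → ⊥-elim (¬used used))
        ; stacked    = subst (StackedBy t) (sym op≡) stacked
        }
        where
        Proc≡ : Proc t ≡ p
        Proc≡ = Proc-down eq
        enum′ : Enumerates (Live t r) (p ∷ ps)
        enum′ = subst (Enumerates (Live t r)) eq (proj₂ (stk r))
        live : Live t r (Proc t)
        live = subst (Live t r) (sym Proc≡) (proj₁ enum′)
        used : Used t
        used = live-used live
        store≡ : store t r ≡ suc (length ps)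
        store≡ = trans (sym (proj₁ (stk r))) (cong length eq)
        label : proj₁ (exec (down r l l′) (store t)) ≡ l
        label rewrite store≡ = refl
        is-matched : Matched t
        is-matched j j<t eq with live
        -- The process is numbered by the time `j₀` of its increment, so a move before `j₀` cannot
        -- be on it; a move after `j₀` would contradict liveness.
        ... | j₀ , j₀<t , ups , eq₀ , last with <-cmp j j₀
        ...   | tri< j<j₀ _ _ = ⊥-elim (<⇒≱ j<j₀ (subst (_≤ j) (trans eq (trans (sym eq₀) (Proc-up ups))) (Proc-≤ j)))
        ...   | tri≈ _ refl _ = subst (Match _) (sym op≡) (ups-match ups)
        ...   | tri> _ _ j₀<j = ⊥-elim (last j j₀<j j<t eq)
        other : ∀ {r′} → r ≢ r′ → ¬ Live t r′ (Proc t)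
        other r≢r′ (j , j<t , ups , eq , _) =
          r≢r′ (ups-unique (match-ups (subst (Match _) op≡ (is-matched j j<t eq))) ups)
        stacked : StackedBy t (down r l l′)
        stacked r′ rewrite store≡ with r ≟ r′ | stk r′
        ... | yes refl | _ rewrite eq = refl ,
          pop ps no-ups (subst (λ p → Enumerates (λ q → Live t r q × q ≢ p) ps) (sym Proc≡) (proj₂ enum′))
        ... | no r≢r′  | len , enum = len , keep _ no-ups (other r≢r′) enum

    stage : Stage t
    stage = go (op (PC t)) refl
      where
      go : ∀ i → op (PC t) ≡ i → Stage t
      go (up _ _)     op≡ = stage-up op≡
      go (down r _ _) op≡ with stacks t r in eq
      ... | []    = stage-zero op≡ eq
      ... | _ ∷ _ = stage-positive op≡ eq

  stacked : ∀ t → Stacked t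
  stacked zero    r = refl , λ { _ (_ , () , _) }
  stacked (suc t) = Stage.stacked (stage (stacked t))

  canonical-good : ∀ k → Good PC Proc k
  canonical-good k = record
    { pc-load₀  = λ t _ → PC-load₀
    ; pc-load₁  = λ t _ → PC-load₁
    ; pc-start  = λ _ → PC-start
    ; matched   = λ t _ → Stage.is-matched (stage (stacked t))
    ; zero-test = λ t _ → Stage.zero-test (stage (stacked t))
    ; next      = λ t _ 2≤PC → Stage.next (stage (stacked t)) (late 2≤PC)
    }
    where
    late : ∀ {t} → 2 ≤ PC t → m + n ≤ t
    late {t} 2≤PC with phase t
    ... | load₀ t<m       = ⊥-elim (<⇒≱ (s≤s z≤n) (subst (2 ≤_) (PC-load₀ t<m) 2≤PC))
    ... | load₁ m≤t t<m+n = ⊥-elim (<⇒≱ (s≤s (s≤s z≤n)) (subst (2 ≤_) (PC-load₁ m≤t t<m+n) 2≤PC))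
    ... | start refl      = ≤-refl
    ... | running m+n<t   = <⇒≤ m+n<t

-- The sentence

infixr 5 _⇒̇_

_⇒̇_ : ∀ {A a b} → Formula A a b → Formula A a b → Formula A a b
φ ⇒̇ ψ = ¬̇ (φ ∧̇ ¬̇ ψ)

⊤̇ : ∀ {A a b} → Formula A a b
⊤̇ = ∀x (x ≐ x)

-- Conditions on the instructions behind letters are evaluated while the formula is built.
truth : ∀ {A a b} {X : Set} → Dec X → Formula A a b
truth (yes _) = ⊤̇
truth (no  _) = ¬̇ ⊤̇

⋀ : ∀ {A a b} n → (Fin n → Formula A a b) → Formula A a b
⋀ zero    Φ = ⊤̇
⋀ (suc n) Φ = Φ zero ∧̇ ⋀ n (Φ ∘ suc)

-- Environment has a single action: it challenges System to stop, and the
-- formula then constrains only the positions before the first challenge.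
module _ {n : ℕ} where

  Φ : Bool → Bool → Set
  Φ = Formula (alphabet n 1)

  challenge : ∀ {a b} → Var a b → Φ a b
  challenge = act (inj₂ zero)

  whenLetter : ∀ {a b} → Var a b → (Fin n → Φ a b) → Φ a b
  whenLetter v φ = ⋀ n λ i → act (inj₁ i) v ⇒̇ φ i

  -- For positions, the negation of `x ≺ y` is `y ≤ x`, so the challenge itself is not active.
  -- Process elements are incomparable to everything and have to be excluded separately.
  active : ∀ {b} → Φ true b
  active = ¬̇ sys x ∧̇ ¬̇ env x ∧̇ ¬̇ ∃y (¬̇ (x ≺ y) ∧̇ challenge y)

  -- The quantifier `∃x (x ≐ y ∧̇ ...)` copies `y` back to `x`, which lets two variables describe a
  -- chain of any length.
  atLeast : ∀ {b} → ℕ → Φ true b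
  atLeast zero    = x ≐ x
  atLeast (suc k) = ∃y (y ≺ x ∧̇ ∃x (x ≐ y ∧̇ atLeast k))

  followed : ∀ {b} → ℕ → Φ true b
  followed zero    = x ≐ x
  followed (suc k) = ∃y (x ≺ y ∧̇ ∃x (x ≐ y ∧̇ active ∧̇ followed k))

module InputFormula (m n : ℕ) where

  window : ℕ → ℕ → Fin 3 → Formula (alphabet 3 1) true false
  window k l i = (atLeast k ∧̇ ¬̇ atLeast l) ⇒̇ act (inj₁ i) x

  windows : Formula (alphabet 3 1) true false
  windows = window 0 m zero ∧̇ window m (m + n) (suc zero) ∧̇
            window (m + n) (suc (m + n)) (suc (suc zero))

  input : Sentence (alphabet 3 1)
  input = ∀x (active ⇒̇ windows)

-- The input formula is written with three System actions, independently of the program, and moved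
-- to the alphabet of the game afterwards. An action is coded by its number alone, so the code stays
-- the same.
widen : ∀ {n a b} k → Formula (alphabet n 1) a b → Formula (alphabet (n + k) 1) a b
widen k (act (inj₁ i) v) = act (inj₁ (i ↑ˡ k)) v
widen k (act (inj₂ i) v) = act (inj₂ i) v
widen k (v ≐ v′)   = v ≐ v′
widen k (v ≺ v′)   = v ≺ v′
widen k (v ∼ v′)   = v ∼ v′
widen k (sys v)    = sys v
widen k (env v)    = env v
widen k (shared v) = shared v
widen k (¬̇ φ)      = ¬̇ widen k φ
widen k (φ ∧̇ ψ)    = widen k φ ∧̇ widen k ψ
widen k (φ ∨̇ ψ)    = widen k φ ∨̇ widen k ψ
widen k (∃x φ)     = ∃x (widen k φ)
widen k (∀x φ)     = ∀x (widen k φ)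
widen k (∃y φ)     = ∃y (widen k φ)
widen k (∀y φ)     = ∀y (widen k φ)

code-widen : ∀ {n a b} k (φ : Formula (alphabet n 1) a b) → codeFormula (widen k φ) ≡ codeFormula φ
code-widen k (act (inj₁ i) v) = cong (λ j → ⟨ 0 , ⟨ ⟨ 0 , j ⟩ , codeVar v ⟩ ⟩) (toℕ-↑ˡ i k)
code-widen k (act (inj₂ i) v) = refl
code-widen k (v ≐ v′)   = refl
code-widen k (v ≺ v′)   = refl
code-widen k (v ∼ v′)   = refl
code-widen k (sys v)    = refl
code-widen k (env v)    = refl
code-widen k (shared v) = refl
code-widen k (¬̇ φ)      = cong ⟨ 7 ,_⟩ (code-widen k φ)
code-widen k (φ ∧̇ ψ)    = cong₂ (λ i j → ⟨ 8 , ⟨ i , j ⟩ ⟩) (code-widen k φ) (code-widen k ψ)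
code-widen k (φ ∨̇ ψ)    = cong₂ (λ i j → ⟨ 9 , ⟨ i , j ⟩ ⟩) (code-widen k φ) (code-widen k ψ)
code-widen k (∃x φ)     = cong ⟨ 10 ,_⟩ (code-widen k φ)
code-widen k (∀x φ)     = cong ⟨ 11 ,_⟩ (code-widen k φ)
code-widen k (∃y φ)     = cong ⟨ 12 ,_⟩ (code-widen k φ)
code-widen k (∀y φ)     = cong ⟨ 13 ,_⟩ (code-widen k φ)

module ProgramFormula (c : List Instr) {n : ℕ} where

  private
    op : ℕ → Instr
    op = letterOp c

  is : ∀ {b} → ℕ → Fin n → Φ {n} true b
  is l a = truth (toℕ a ≟ l)

  at : ∀ {b} → ℕ → Φ {n} true b
  at l = whenLetter x (is l)

  precedesX precedesY : Φ {n} true true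
  precedesX = y ≺ x ∧̇ y ∼ x
  precedesY = x ≺ y ∧̇ x ∼ y

  preceded : Φ {n} true false
  preceded = ∃y precedesX

  precededY : Φ {n} true true
  precededY = ∃x precedesY

  matches : Instr → Fin n → Φ {n} true true
  matches i b = truth (match? (op (toℕ b)) i)

  matchedBy : Fin n → Φ {n} true false
  matchedBy a = ∀y (precedesX ⇒̇ whenLetter y (matches (op (toℕ a))))

  matched : Φ {n} true false
  matched = whenLetter x matchedBy

  upsY : ℕ → Fin n → Φ {n} true true
  upsY r b = truth (ups? r (op (toℕ b)))

  -- Quantifying `x` anew forgets the position of the test. That position being the last active one,
  -- `active` takes over as the upper bound for the decrement.
  matchedLater : Φ {n} true true
  matchedLater = ∃x (active ∧̇ precedesX)

  consumed : ℕ → Φ {n} true true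
  consumed r = whenLetter y λ b → upsY r b ⇒̇ matchedLater

  zeroTest : Instr → Φ {n} true false
  zeroTest (up _ _)     = ⊤̇
  zeroTest (down r _ _) = ¬̇ preceded ⇒̇ ∀y (y ≺ x ⇒̇ consumed r)

  next : Instr → Φ {n} true true
  next (up _ l)      = at (2 + l)
  next (down _ l l′) = (precededY ⇒̇ at (2 + l)) ∧̇ (¬̇ precededY ⇒̇ at (2 + l′))

  -- Used where `x` is the last active position; then `x` is the only active position after `y`.
  penultimate : Φ {n} true true
  penultimate = y ≺ x ∧̇ ¬̇ ∃x (x ≐ y ∧̇ followed 2)

  runningY : Fin n → Φ {n} true true
  runningY b = truth (2 ≤? toℕ b)

  nextLetter : Φ {n} true true
  nextLetter = whenLetter y λ b → runningY b ⇒̇ next (op (toℕ b))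

  successor : Φ {n} true false
  successor = ∀y (penultimate ⇒̇ nextLetter)

  lastMove : Φ {n} true false
  lastMove = whenLetter x (zeroTest ∘ op ∘ toℕ) ∧̇ successor

  moves : Φ {n} true false
  moves = matched ∧̇ (¬̇ followed 1 ⇒̇ lastMove)

  simulation : Φ {n} false false
  simulation = ∀x (active ⇒̇ moves)

  unchallenged : Φ {n} false false
  unchallenged = ¬̇ ∃x (challenge x)

  reaches : Fin n → Φ {n} false false
  reaches h = ∃x (act (inj₁ h) x)

  halting : Fin n → Φ {n} false false
  halting h = unchallenged ⇒̇ reaches h

  -- The conjunct `∃x (env x)` keeps System from winning by a choice of process sets that leaves
  -- Environment without moves.
  programFormula : Fin n → Φ {n} false false
  programFormula h = ∃x (env x) ∧̇ halting h ∧̇ simulation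

-- Classical reasoning about satisfaction

module Semantics {A : Alphabet} {p q : ℕ} (w : Game.Word A p q) where

  open Game A p q
  open Structure w

  _≟ₚ_ : DecidableEquality Process
  _≟ₚ_ = ≡-dec Fin._≟_ Fin._≟_

  _≟ₚₒₛ_ : DecidableEquality (Pos w)
  _≟ₚₒₛ_ = pos w
    where
    pos : ∀ w → DecidableEquality (Pos w)
    pos (fin u) = Fin._≟_
    pos (inf s) = _≟_

  -- Needed because `⇒̇` is a negated conjunction, so that modus ponens yields its conclusion only
  -- doubly negated. Atoms are decidable, and the other clauses inherit stability.
  sat-stable : ∀ {a b} ρ (φ : Formula A a b) → Stable (Sat ρ φ)
  sat-stable ρ (act a v) ¬¬s with ⟦ v ⟧ ρ
  ... | inj₁ i = decidable-stable (≡-dec Fin._≟_ Fin._≟_ _ _) ¬¬s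
  ... | inj₂ _ = ¬¬s id
  sat-stable ρ (v ≐ v′) = decidable-stable (≡-dec _≟ₚₒₛ_ _≟ₚ_ _ _)
  sat-stable ρ (v ≺ v′) ¬¬s with ⟦ v ⟧ ρ | ⟦ v′ ⟧ ρ
  ... | inj₁ i | inj₁ j = decidable-stable (_ <? _) ¬¬s
  ... | inj₁ _ | inj₂ _ = ¬¬s id
  ... | inj₂ _ | _      = ¬¬s id
  sat-stable ρ (v ∼ v′) = decidable-stable (_ ≟ₚ _)
  sat-stable ρ (sys v) ¬¬s with ⟦ v ⟧ ρ
  ... | inj₁ _        = ⊥-elim (¬¬s λ ())
  ... | inj₂ (inj₁ r) = r , refl
  ... | inj₂ (inj₂ _) = ⊥-elim (¬¬s λ ())
  sat-stable ρ (env v) ¬¬s with ⟦ v ⟧ ρ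
  ... | inj₁ _        = ⊥-elim (¬¬s λ ())
  ... | inj₂ (inj₁ _) = ⊥-elim (¬¬s λ ())
  ... | inj₂ (inj₂ r) = r , refl
  sat-stable ρ (shared v) ¬¬s = ¬¬s id
  sat-stable ρ (¬̇ φ) ¬¬s s = ¬¬s λ ¬s → ¬s s
  sat-stable ρ (φ ∧̇ ψ) ¬¬s =
    sat-stable ρ φ (λ ¬s → ¬¬s (¬s ∘ proj₁)) , sat-stable ρ ψ (λ ¬s → ¬¬s (¬s ∘ proj₂))
  sat-stable ρ (φ ∨̇ ψ) ¬¬s ¬s = ¬¬s λ s → s ¬s
  sat-stable ρ (∃x φ) ¬¬s ¬s = ¬¬s λ s → s ¬s
  sat-stable ρ (∀x φ) ¬¬s d = sat-stable _ φ λ ¬s → ¬¬s λ s → ¬s (s d)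
  sat-stable ρ (∃y φ) ¬¬s ¬s = ¬¬s λ s → s ¬s
  sat-stable ρ (∀y φ) ¬¬s d = sat-stable _ φ λ ¬s → ¬¬s λ s → ¬s (s d)

  ⇒-intro : ∀ {a b} (ρ : Assignment a b) φ ψ → (Sat ρ φ → Sat ρ ψ) → Sat ρ (φ ⇒̇ ψ)
  ⇒-intro ρ φ ψ f (s , ¬t) = ¬t (f s)

  ⇒-elim : ∀ {a b} (ρ : Assignment a b) φ ψ → Sat ρ (φ ⇒̇ ψ) → Sat ρ φ → Sat ρ ψ
  ⇒-elim ρ φ ψ f s = sat-stable ρ ψ λ ¬t → f (s , ¬t)

  truth-intro : ∀ {a b} (ρ : Assignment a b) {X : Set} (d : Dec X) → X → Sat ρ (truth d)
  truth-intro ρ (yes _) _ = λ _ → refl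
  truth-intro ρ (no ¬X) X = ⊥-elim (¬X X)

  truth-elim : ∀ {a b} (ρ : Assignment a b) {X : Set} (d : Dec X) → Sat ρ (truth d) → X
  truth-elim ρ (yes X) _ = X
  truth-elim ρ (no _)  s = ⊥-elim (s λ _ → refl)

  ⋀-intro : ∀ {a b} (ρ : Assignment a b) n φ → (∀ i → Sat ρ (φ i)) → Sat ρ (⋀ n φ)
  ⋀-intro ρ zero    φ s = λ _ → refl
  ⋀-intro ρ (suc n) φ s = s zero , ⋀-intro ρ n (φ ∘ suc) (s ∘ suc)

  ⋀-elim : ∀ {a b} (ρ : Assignment a b) n φ → Sat ρ (⋀ n φ) → ∀ i → Sat ρ (φ i)
  ⋀-elim ρ (suc n) φ (s , _) zero    = s
  ⋀-elim ρ (suc n) φ (_ , s) (suc i) = ⋀-elim ρ n (φ ∘ suc) s i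

-- The meaning of the sentence

-- The moves of w before the first challenge are those of System at the
-- times below N.
record Shape {n p q : ℕ} (w : Game.Word (alphabet n 1) p q) (pc proc : ℕ → ℕ) (N : ℕ) : Set where
  open Game (alphabet n 1) p q
  field
    played     : ∀ i → index w i < N → ∃₂ λ a r → letter w i ≡ inj₁ (a , r) ×
                 toℕ a ≡ pc (index w i) × toℕ r ≡ proc (index w i)
    position   : ∀ k → k < N → ∃ λ i → index w i ≡ k
    challenged : ∀ i → N ≤ index w i → ∃₂ λ j e → index w j ≤ index w i × letter w j ≡ inj₂ e

module Meaning {n p q : ℕ} (w : Game.Word (alphabet n 1) p q) {pc proc : ℕ → ℕ} {N : ℕ}
               (shape : Shape w pc proc N) where

  open Game (alphabet n 1) p q
  open Structure w
  open Semantics w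
  open Shape shape

  Active : Element → Set
  Active (inj₁ i) = index w i < N
  Active (inj₂ _) = ⊥

  active-intro : ∀ {b} (f : Value b) d → Active d → Sat (d , f) active
  active-intro _ (inj₁ i) i<N = (λ ()) , (λ ()) , λ ¬¬∃ → ¬¬∃ no-challenge
    where
    no-challenge : ¬ ∃ λ d → ¬ Before (inj₁ i) d × HasAction (inj₂ zero) d
    no-challenge (inj₁ j , i≮j , act≡) with played j (≤-<-trans (≮⇒≥ i≮j) i<N)
    ... | a , r , eq , _ rewrite eq with act≡
    ...   | ()

  active-elim : ∀ {b} (f : Value b) d → Sat (d , f) active → Active d
  active-elim _ (inj₂ (inj₁ r)) (¬sys , _)     = ¬sys (r , refl)
  active-elim _ (inj₂ (inj₂ r)) (_ , ¬env , _) = ¬env (r , refl)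
  active-elim _ (inj₁ i) (_ , _ , unchallenged) = decidable-stable (index w i <? N) λ i≮N →
    unchallenged (λ ¬∃ → ¬∃ (challenge-at (challenged i (≮⇒≥ i≮N))))
    where
    challenge-at : (∃₂ λ j e → index w j ≤ index w i × letter w j ≡ inj₂ e) →
                   ∃ λ d → ¬ Before (inj₁ i) d × HasAction (inj₂ zero) d
    challenge-at (j , (zero , _) , j≤i , eq) = inj₁ j , ≤⇒≯ j≤i , cong action eq

  letter-intro : ∀ {a i} → index w i < N → toℕ a ≡ pc (index w i) → HasAction (inj₁ a) (inj₁ i)
  letter-intro i<N a≡ with played _ i<N
  ... | a′ , r , eq , a′≡ , _ = trans (cong action eq) (cong inj₁ (toℕ-injective (trans a′≡ (sym a≡))))

  letter-elim : ∀ {a i} → index w i < N → HasAction (inj₁ a) (inj₁ i) → toℕ a ≡ pc (index w i)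
  letter-elim i<N act≡ with played _ i<N
  ... | a′ , r , eq , a′≡ , _ =
    trans (cong toℕ (inj₁-injective (trans (sym act≡) (cong action eq)))) a′≡

  has-letter : ∀ {i} → index w i < N → ∃ λ a → toℕ a ≡ pc (index w i)
  has-letter i<N with played _ i<N
  ... | a , _ , _ , eq , _ = a , eq

  ∼-intro : ∀ {i j} → index w i < N → index w j < N → proc (index w i) ≡ proc (index w j) →
            owner (inj₁ i) ≡ owner (inj₁ j)
  ∼-intro i<N j<N same with played _ i<N | played _ j<N
  ... | _ , r , eq , _ , r≡ | _ , r′ , eq′ , _ , r′≡ =
    trans (cong process eq)
      (trans (cong inj₁ (toℕ-injective (trans r≡ (trans same (sym r′≡))))) (sym (cong process eq′)))

  ∼-elim : ∀ {i j} → index w i < N → index w j < N → owner (inj₁ i) ≡ owner (inj₁ j) →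
           proc (index w i) ≡ proc (index w j)
  ∼-elim i<N j<N same with played _ i<N | played _ j<N
  ... | _ , r , eq , _ , r≡ | _ , r′ , eq′ , _ , r′≡ =
    trans (sym r≡) (trans (cong toℕ (inj₁-injective
      (trans (sym (cong process eq)) (trans same (cong process eq′))))) r′≡)

  whenLetter-intro : ∀ {a b} (ρ : Assignment a b) v φ →
                     (∀ i → HasAction (inj₁ i) (⟦ v ⟧ ρ) → Sat ρ (φ i)) → Sat ρ (whenLetter v φ)
  whenLetter-intro ρ v φ s = ⋀-intro ρ n _ λ i → ⇒-intro ρ (act (inj₁ i) v) (φ i) (s i)

  whenLetter-elim : ∀ {a b} (ρ : Assignment a b) v φ → Sat ρ (whenLetter v φ) →
                    ∀ i → HasAction (inj₁ i) (⟦ v ⟧ ρ) → Sat ρ (φ i)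
  whenLetter-elim ρ v φ s i = ⇒-elim ρ (act (inj₁ i) v) (φ i) (⋀-elim ρ n _ s i)

  followed-intro : ∀ {b} {f : Value b} k i → k + index w i < N → Sat (inj₁ i , f) (followed k)
  followed-intro zero    i _ = refl
  followed-intro (suc k) i lt ¬∃ =
    let j , eq = position (suc (index w i)) (≤-trans (s≤s (s≤s (m≤n+m (index w i) k))) lt)
        lt′ = subst (_< N) (trans (sym (+-suc k (index w i))) (cong (k +_) (sym eq))) lt
    in ¬∃ (inj₁ j , subst (index w i <_) (sym eq) (n<1+n _) , λ ¬∃′ →
         ¬∃′ (inj₁ j , refl ,
           active-intro {true} (inj₁ j) (inj₁ j) (≤-trans (s≤s (m≤n+m (index w j) k)) lt′) ,
           followed-intro k j lt′))

  followed-elim : ∀ {b} {f : Value b} k i → index w i < N → Sat (inj₁ i , f) (followed k) → k + index w i < N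
  followed-elim zero    i i<N _ = i<N
  followed-elim (suc k) i i<N ∃∃ = decidable-stable (suc k + index w i <? N) λ ≮N →
    ∃∃ λ { (inj₁ j , i<j , ∃∃′) → ∃∃′ λ { (_ , refl , s , fol) →
      ≮N (≤-<-trans (subst (_≤ k + index w j) (+-suc k (index w i)) (+-monoʳ-≤ k i<j))
        (followed-elim k j (active-elim {true} (inj₁ j) (inj₁ j) s) fol)) } }

module MeaningWide {k p q : ℕ} (w : Game.Word (alphabet (3 + k) 1) p q) {pc proc : ℕ → ℕ} {N : ℕ}
                   (shape : Shape w pc proc N) where

  open Game (alphabet (3 + k) 1) p q
  open Structure w
  open Semantics w
  open Shape shape
  open Meaning w shape

  atLeast-intro : ∀ {b} {f : Value b} l i → index w i < N → l ≤ index w i →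
                  Sat (inj₁ i , f) (widen {3} k (atLeast l))
  atLeast-intro zero    i i<N _ = refl
  atLeast-intro (suc l) i i<N l<i ¬∃ =
    let j , eq = position l (<-trans l<i i<N)
        j<i = subst (_< index w i) (sym eq) l<i
    in ¬∃ (inj₁ j , j<i , λ ¬∃′ → ¬∃′ (inj₁ j , refl , atLeast-intro l j (<-trans j<i i<N) (≤-reflexive (sym eq))))

  atLeast-elim : ∀ {b} {f : Value b} l i → Sat (inj₁ i , f) (widen {3} k (atLeast l)) → l ≤ index w i
  atLeast-elim zero    i _ = z≤n
  atLeast-elim (suc l) i ∃∃ = decidable-stable (suc l ≤? index w i) λ l≮i →
    ∃∃ λ { (inj₁ j , j<i , ∃∃′) → ∃∃′ λ { (_ , refl , s) → l≮i (≤-<-trans (atLeast-elim l j s) j<i) } }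

  Window : ℕ → ℕ → Fin 3 → Set
  Window l l′ a = ∀ t → t < N → l ≤ t → t < l′ → pc t ≡ toℕ a

  module _ (m d : ℕ) where

    open InputFormula m d

    window-intro : ∀ l l′ a i → index w i < N → Window l l′ a →
                   Sat (inj₁ i , _) (widen k (window l l′ a))
    window-intro l l′ a i i<N win =
      ⇒-intro (inj₁ i , _) (widen k (atLeast l ∧̇ ¬̇ atLeast l′)) (act (inj₁ (a ↑ˡ k)) x) λ (l≤i , ¬l′≤i) →
      letter-intro i<N (trans (toℕ-↑ˡ a k) (sym (win (index w i) i<N (atLeast-elim l i l≤i)
        (≰⇒> (¬l′≤i ∘ atLeast-intro l′ i i<N)))))

    window-elim : ∀ l l′ a i → index w i < N → Sat (inj₁ i , _) (widen k (window l l′ a)) →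
                  l ≤ index w i → index w i < l′ → pc (index w i) ≡ toℕ a
    window-elim l l′ a i i<N s l≤i i<l′ = trans (sym (letter-elim i<N
      (⇒-elim (inj₁ i , _) (widen k (atLeast l ∧̇ ¬̇ atLeast l′)) (act (inj₁ (a ↑ˡ k)) x) s
        (atLeast-intro l i i<N l≤i , λ l′≤i → <⇒≱ i<l′ (atLeast-elim l′ i l′≤i))))) (toℕ-↑ˡ a k)

    input-intro : Window 0 m zero → Window m (m + d) (suc zero) → Window (m + d) (suc (m + d)) (suc (suc zero)) →
                  w ⊨ widen k input
    input-intro win₀ win₁ win₂ e = ⇒-intro (e , _) active (widen k windows) (go e ∘ active-elim {false} tt e)
      where
      go : ∀ e → Active e → Sat (e , _) (widen k windows)
      go (inj₁ i) i<N = window-intro 0 m zero i i<N win₀ , window-intro m (m + d) (suc zero) i i<N win₁ ,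
                        window-intro (m + d) (suc (m + d)) (suc (suc zero)) i i<N win₂

    input-elim : w ⊨ widen k input →
                 Window 0 m zero × Window m (m + d) (suc zero) × Window (m + d) (suc (m + d)) (suc (suc zero))
    input-elim s = (λ t t<N → at₀ t t<N) , (λ t t<N → at₁ t t<N) , (λ t t<N → at₂ t t<N)
      where
      sat : ∀ i → index w i < N → Sat (inj₁ i , _) (widen k windows)
      sat i i<N = ⇒-elim (inj₁ i , _) active (widen k windows) (s (inj₁ i)) (active-intro {false} tt (inj₁ i) i<N)
      at₀ : Window 0 m zero
      at₀ t t<N with position t t<N
      ... | i , refl = window-elim 0 m zero i t<N (proj₁ (sat i t<N))
      at₁ : Window m (m + d) (suc zero)
      at₁ t t<N with position t t<N
      ... | i , refl = window-elim m (m + d) (suc zero) i t<N (proj₁ (proj₂ (sat i t<N)))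
      at₂ : Window (m + d) (suc (m + d)) (suc (suc zero))
      at₂ t t<N with position t t<N
      ... | i , refl = window-elim (m + d) (suc (m + d)) (suc (suc zero)) i t<N (proj₂ (proj₂ (sat i t<N)))

module Simulation (c : List Instr) {n p q : ℕ} (w : Game.Word (alphabet n 1) p q)
                  {pc proc : ℕ → ℕ} {N : ℕ} (shape : Shape w pc proc N) where

  open ProgramFormula c {n}
  open Game (alphabet n 1) p q
  open Structure w
  open Semantics w
  open Shape shape
  open Meaning w shape

  op : ℕ → Instr
  op = letterOp c

  open Trace op pc proc

  at-intro : ∀ {b} (f : Value b) l i → index w i < N → pc (index w i) ≡ l → Sat (inj₁ i , f) (at l)
  at-intro f l i i<N pc≡ = whenLetter-intro (inj₁ i , f) x (is l) λ a act≡ →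
    truth-intro (inj₁ i , f) (toℕ a ≟ _) (trans (letter-elim i<N act≡) pc≡)

  at-elim : ∀ {b} (f : Value b) l i → index w i < N → Sat (inj₁ i , f) (at l) → pc (index w i) ≡ l
  at-elim f l i i<N s with has-letter i<N
  ... | a , a≡ = trans (sym a≡) (truth-elim (inj₁ i , f) (toℕ a ≟ l)
    (whenLetter-elim (inj₁ i , f) x (is l) s a (letter-intro i<N a≡)))

  matched-intro : ∀ i → index w i < N → Matched (index w i) → Sat (inj₁ i , _) matched
  matched-intro i i<N mat = whenLetter-intro (inj₁ i , _) x matchedBy λ a act≡ e →
    ⇒-intro (inj₁ i , e) precedesX (whenLetter y (matches (op (toℕ a)))) (go a act≡ e)
    where
    go : ∀ a → HasAction (inj₁ a) (inj₁ i) → ∀ e → Sat (inj₁ i , e) precedesX →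
         Sat (inj₁ i , e) (whenLetter y (matches (op (toℕ a))))
    go a act≡ (inj₁ j) (j<i , same) = whenLetter-intro (inj₁ i , inj₁ j) y (matches (op (toℕ a))) λ b act≡′ →
      truth-intro (inj₁ i , inj₁ j) (match? _ _) (subst₂ (λ b a → Match (op b) (op a))
        (sym (letter-elim j<N act≡′)) (sym (letter-elim i<N act≡)) (mat (index w j) j<i (∼-elim j<N i<N same)))
      where j<N = <-trans j<i i<N

  matched-elim : ∀ i → index w i < N → Sat (inj₁ i , _) matched → Matched (index w i)
  matched-elim i i<N s t t<i same with position t (<-trans t<i i<N)
  ... | j , refl with has-letter i<N | has-letter (<-trans t<i i<N)
  ...   | a , a≡ | b , b≡ = subst₂ (λ b a → Match (op b) (op a)) b≡ a≡ (truth-elim (inj₁ i , inj₁ j) (match? _ _)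
    (whenLetter-elim (inj₁ i , inj₁ j) y (matches (op (toℕ a)))
      (⇒-elim (inj₁ i , inj₁ j) precedesX (whenLetter y (matches (op (toℕ a))))
        (whenLetter-elim (inj₁ i , _) x matchedBy s a (letter-intro i<N a≡) (inj₁ j))
        (t<i , ∼-intro j<N i<N same))
      b (letter-intro j<N b≡)))
    where j<N = <-trans t<i i<N

  preceded-intro : ∀ i → index w i < N → Used (index w i) → Sat (inj₁ i , _) preceded
  preceded-intro i i<N (t , t<i , same) with position t (<-trans t<i i<N)
  ... | j , refl = λ ¬∃ → ¬∃ (inj₁ j , t<i , ∼-intro (<-trans t<i i<N) i<N same)

  preceded-elim : ∀ i → index w i < N → Sat (inj₁ i , _) preceded → Used (index w i)
  preceded-elim i i<N s = decidable-stable (used? (index w i)) λ ¬used →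
    s λ { (inj₁ j , j<i , same) → ¬used (index w j , j<i , ∼-elim (<-trans j<i i<N) i<N same) }

  precededʸ-intro : ∀ (e : Element) i → index w i < N → Used (index w i) → Sat (e , inj₁ i) precededY
  precededʸ-intro e i i<N used s = preceded-intro i i<N used λ (j , lt , same) → s (j , lt , same)

  precededʸ-elim : ∀ (e : Element) i → index w i < N → Sat (e , inj₁ i) precededY → Used (index w i)
  precededʸ-elim e i i<N s = preceded-elim i i<N λ ¬∃ → s λ (j , lt , same) → ¬∃ (j , lt , same)

  -- With `i` the last active position, `k ≤ index w i` and `k < N` coincide, which is how the bound
  -- of `ZeroTest` becomes `active`.
  zeroTest-intro : ∀ i → suc (index w i) ≡ N → ∀ o → ZeroTest (index w i) o → Sat (inj₁ i , _) (zeroTest o)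
  zeroTest-intro i refl (up _ _)     test = λ _ → refl
  zeroTest-intro i refl (down r _ _) test = ⇒-intro (inj₁ i , _) (¬̇ preceded) (∀y (y ≺ x ⇒̇ consumed r))
    λ unpreceded e → ⇒-intro (inj₁ i , e) (y ≺ x) (consumed r) (go (unpreceded ∘ preceded-intro i i<N) e)
    where
    i<N = n<1+n (index w i)
    go : ¬ Used (index w i) → ∀ e → Sat (inj₁ i , e) (y ≺ x) → Sat (inj₁ i , e) (consumed r)
    go unused (inj₁ j) j<i = whenLetter-intro (inj₁ i , inj₁ j) y (λ b → upsY r b ⇒̇ matchedLater) λ b act≡ →
      ⇒-intro (inj₁ i , inj₁ j) (upsY r b) matchedLater λ ups ¬∃ →
        test unused (index w j) j<i
          (subst (Ups r ∘ op) (letter-elim j<N act≡) (truth-elim (inj₁ i , inj₁ j) (ups? r (op (toℕ b))) ups))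
          λ (k , k≤i , j<k , same) → later k (s≤s k≤i) j<k same ¬∃
      where
      j<N = <-trans j<i i<N
      later : ∀ k → k < N → index w j < k → proc (index w j) ≡ proc k →
              Sat (inj₁ i , inj₁ j) matchedLater
      later k k<N j<k same ¬∃ with position k k<N
      ... | l , refl = ¬∃ (inj₁ l , active-intro {true} (inj₁ j) (inj₁ l) k<N , j<k , ∼-intro j<N k<N same)

  zeroTest-elim : ∀ i → suc (index w i) ≡ N → ∀ o → Sat (inj₁ i , _) (zeroTest o) → ZeroTest (index w i) o
  zeroTest-elim i refl (up _ _)     s = tt
  zeroTest-elim i refl (down r _ _) s unused t t<i ups unmatched with position t (m<n⇒m<1+n t<i)
  ... | j , refl with has-letter (m<n⇒m<1+n t<i)
  ...   | b , b≡ = ⇒-elim (inj₁ i , inj₁ j) (upsY r b) matchedLater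
    (whenLetter-elim (inj₁ i , inj₁ j) y (λ b → upsY r b ⇒̇ matchedLater)
      (⇒-elim (inj₁ i , inj₁ j) (y ≺ x) (consumed r)
      (⇒-elim (inj₁ i , _) (¬̇ preceded) (∀y (y ≺ x ⇒̇ consumed r)) s (unused ∘ preceded-elim i (n<1+n _)) (inj₁ j))
      t<i) b (letter-intro j<N b≡))
    (truth-intro (inj₁ i , inj₁ j) (ups? r (op (toℕ b))) (subst (Ups r ∘ op) (sym b≡) ups)) contra
    where
    j<N = m<n⇒m<1+n t<i
    contra : ¬ ∃ λ d → Sat (d , inj₁ j) (active ∧̇ precedesX)
    contra (inj₂ d , act′ , _) = active-elim {true} (inj₁ j) (inj₂ d) act′
    contra (inj₁ l , act′ , j<l , same) =
      unmatched (index w l , ≤-pred l<N , j<l , ∼-elim j<N l<N same)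
      where l<N = active-elim {true} (inj₁ j) (inj₁ l) act′

  next-intro : ∀ i j → index w i < N → index w i ≡ suc (index w j) → ∀ o → Next (index w j) o →
               Sat (inj₁ i , inj₁ j) (next o)
  next-intro i j i<N eq (up _ l)      nxt = at-intro (inj₁ j) (2 + l) i i<N (trans (cong pc eq) nxt)
  next-intro i j i<N eq (down _ l l′) (nxt , nxt′) =
    ⇒-intro (inj₁ i , inj₁ j) precededY (at (2 + l))
      (λ s → at-intro (inj₁ j) (2 + l) i i<N (trans (cong pc eq) (nxt (precededʸ-elim (inj₁ i) j j<N s)))) ,
    ⇒-intro (inj₁ i , inj₁ j) (¬̇ precededY) (at (2 + l′))
      (λ s → at-intro (inj₁ j) (2 + l′) i i<N (trans (cong pc eq) (nxt′ (s ∘ precededʸ-intro (inj₁ i) j j<N))))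
    where j<N = <-trans (subst (index w j <_) (sym eq) (n<1+n _)) i<N

  next-elim : ∀ i j → index w i < N → index w i ≡ suc (index w j) → ∀ o →
              Sat (inj₁ i , inj₁ j) (next o) → Next (index w j) o
  next-elim i j i<N eq (up _ l)      s = trans (cong pc (sym eq)) (at-elim (inj₁ j) (2 + l) i i<N s)
  next-elim i j i<N eq (down _ l l′) (s , s′) =
    (λ used → trans (cong pc (sym eq)) (at-elim (inj₁ j) (2 + l) i i<N
      (⇒-elim (inj₁ i , inj₁ j) precededY (at (2 + l)) s (precededʸ-intro (inj₁ i) j j<N used)))) ,
    (λ unused → trans (cong pc (sym eq)) (at-elim (inj₁ j) (2 + l′) i i<N
      (⇒-elim (inj₁ i , inj₁ j) (¬̇ precededY) (at (2 + l′)) s′ (unused ∘ precededʸ-elim (inj₁ i) j j<N))))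
    where j<N = <-trans (subst (index w j <_) (sym eq) (n<1+n _)) i<N

  successor-intro : ∀ i → suc (index w i) ≡ N →
                    (∀ t → suc t ≡ index w i → 2 ≤ pc t → Next t (op (pc t))) → Sat (inj₁ i , _) successor
  successor-intro i refl nxt e = ⇒-intro (inj₁ i , e) penultimate nextLetter (go e)
    where
    go : ∀ e → Sat (inj₁ i , e) penultimate → Sat (inj₁ i , e) nextLetter
    go (inj₁ j) (j<i , pen) =
      whenLetter-intro (inj₁ i , inj₁ j) y (λ b → runningY b ⇒̇ next (op (toℕ b))) λ b act≡ →
      let b≡ = letter-elim j<N act≡ in
      ⇒-intro (inj₁ i , inj₁ j) (runningY b) (next (op (toℕ b))) λ s →
        next-intro i j (n<1+n _) (sym 1+j≡i) (op (toℕ b)) (subst (Next (index w j) ∘ op) (sym b≡)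
          (nxt (index w j) 1+j≡i (subst (2 ≤_) b≡ (truth-elim (inj₁ i , inj₁ j) (2 ≤? toℕ b) s))))
      where
      j<N = m<n⇒m<1+n j<i
      1+j≡i : suc (index w j) ≡ index w i
      1+j≡i = ≤-antisym j<i (≮⇒≥ λ 1+j<i → pen λ ¬∃ →
        ¬∃ (inj₁ j , refl , followed-intro {true} {inj₁ j} 2 j (s≤s 1+j<i)))

  successor-elim : ∀ i → suc (index w i) ≡ N → Sat (inj₁ i , _) successor →
                   ∀ t → suc t ≡ index w i → 2 ≤ pc t → Next t (op (pc t))
  successor-elim i refl s t eq 2≤ with position t (≤-trans (≤-reflexive eq) (n≤1+n _))
  ... | j , refl with has-letter (≤-trans (≤-reflexive eq) (n≤1+n _))
  ...   | b , b≡ = subst (Next (index w j) ∘ op) b≡ (next-elim i j (n<1+n _) (sym eq) (op (toℕ b))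
    (⇒-elim (inj₁ i , inj₁ j) (runningY b) (next (op (toℕ b)))
      (whenLetter-elim (inj₁ i , inj₁ j) y (λ b → runningY b ⇒̇ next (op (toℕ b)))
        (⇒-elim (inj₁ i , inj₁ j) penultimate nextLetter (s (inj₁ j)) (≤-reflexive eq , pen))
        b (letter-intro j<N b≡))
      (truth-intro (inj₁ i , inj₁ j) (2 ≤? toℕ b) (subst (2 ≤_) (sym b≡) 2≤))))
    where
    j<N = ≤-trans (≤-reflexive eq) (n≤1+n _)
    pen : ¬ Sat (inj₁ i , inj₁ j) (∃x (x ≐ y ∧̇ followed 2))
    pen s = s λ { (_ , refl , s′) → <-irrefl eq (≤-pred (followed-elim {true} {inj₁ j} 2 j j<N s′)) }

module SimulationWide (c : List Instr) {k p q : ℕ} (w : Game.Word (alphabet (3 + k) 1) p q)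
                      {pc proc : ℕ → ℕ} {N : ℕ} (shape : Shape w pc proc N) where

  open ProgramFormula c {3 + k}
  open Game (alphabet (3 + k) 1) p q
  open Structure w
  open Semantics w
  open Shape shape
  open Meaning w shape
  open Simulation c w shape
  open Trace op pc proc

  module _ (m d : ℕ) where

    open Loaded c m d using (Good)
    open InputFormula m d
    open MeaningWide w shape

    good-intro : w ⊨ widen k input → w ⊨ simulation → Good pc proc N
    good-intro inp s = record
      { pc-load₀  = λ t t<N → win₀ t t<N z≤n
      ; pc-load₁  = win₁
      ; pc-start  = λ N> → win₂ _ N> ≤-refl (n<1+n _)
      ; matched   = λ t t<N → let i , eq = position t t<N in
                      subst Matched eq (matched-elim i (i<N eq t<N) (proj₁ (sat i (i<N eq t<N))))
      ; zero-test = λ { t refl → let i , eq = position t ≤-refl in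
                      subst (λ t → ZeroTest t (op (pc t))) eq (zero-test i (cong suc eq)) }
      ; next      = λ { t refl 2≤ → let i , eq = position (suc t) ≤-refl in
                      successor-elim i (cong suc eq) (proj₂ (last i (cong suc eq))) t (sym eq) 2≤ }
      }
      where
      win₀ = proj₁ (input-elim m d inp)
      win₁ = proj₁ (proj₂ (input-elim m d inp))
      win₂ = proj₂ (proj₂ (input-elim m d inp))
      i<N : ∀ {i t} → index w i ≡ t → t < N → index w i < N
      i<N refl t<N = t<N
      sat : ∀ i → index w i < N → Sat (inj₁ i , _) moves
      sat i i<N = ⇒-elim (inj₁ i , _) active moves (s (inj₁ i))
        (active-intro {false} tt (inj₁ i) i<N)
      last : ∀ i → suc (index w i) ≡ N → Sat (inj₁ i , _) lastMove
      last i refl = ⇒-elim (inj₁ i , _) (¬̇ followed 1) lastMove (proj₂ (sat i (n<1+n _)))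
        (<-irrefl refl ∘ followed-elim {false} 1 i (n<1+n _))
      zero-test : ∀ i → suc (index w i) ≡ N → ZeroTest (index w i) (op (pc (index w i)))
      zero-test i refl with has-letter {i} (n<1+n _)
      ... | a , a≡ = subst (ZeroTest (index w i) ∘ op) a≡ (zeroTest-elim i refl (op (toℕ a))
        (whenLetter-elim (inj₁ i , _) x (zeroTest ∘ op ∘ toℕ) (proj₁ (last i refl)) a (letter-intro (n<1+n _) a≡)))

    good-elim : Good pc proc N → w ⊨ widen k input × w ⊨ simulation
    good-elim good =
      input-intro m d (λ t t<N _ → pc-load₀ t t<N) pc-load₁ (λ t t<N le lt →
        let eq = ≤-antisym le (≤-pred lt) in trans (cong pc (sym eq)) (pc-start (subst (_< N) (sym eq) t<N))) ,
      λ e → ⇒-intro (e , _) active moves (go e ∘ active-elim {false} tt e)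
      where
      open Good good renaming (matched to all-matched; zero-test to zero-tests; next to nexts)
      go : ∀ e → Active e → Sat (e , _) moves
      go (inj₁ i) i<N =
        matched-intro i i<N (all-matched (index w i) i<N) ,
        ⇒-intro (inj₁ i , _) (¬̇ followed 1) lastMove λ ¬followed →
          let last = ≤-antisym i<N (≮⇒≥ (¬followed ∘ followed-intro {false} 1 i)) in
          whenLetter-intro (inj₁ i , _) x (zeroTest ∘ op ∘ toℕ) (λ a act≡ →
            subst (λ l → Sat (inj₁ i , _) (zeroTest (op l))) (sym (letter-elim i<N act≡)) (zeroTest-intro i last (op (pc (index w i))) (zero-tests (index w i) last))) ,
          successor-intro i last λ t eq → nexts t (trans (cong suc eq) last)

-- The game

module Words (A : Alphabet) (p q : ℕ) where

  open Game A p q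

  index-injective : ∀ w {i j} → index w i ≡ index w j → i ≡ j
  index-injective (fin u) = toℕ-injective
  index-injective (inf s) = id

  length-before : ∀ w i → length (before w i) ≡ index w i
  length-before (fin u) i = trans (length-take (toℕ i) u) (m≤n⇒m⊓n≡m (<⇒≤ (toℕ<n i)))
  length-before (inf s) i = length-applyUpTo s i

  -- No position lies beyond the length of the word, so the premise of fairness fails.
  fair-fin : ∀ S u → Fair S (fin u)
  fair-fin S u often k = ⊥-elim (often (length u) λ (i , u≤i , _) → <⇒≱ (toℕ<n i) u≤i)

take-applyUpTo : ∀ {X : Set} (s : ℕ → X) {k n} → k ≤ n → take k (applyUpTo s n) ≡ applyUpTo s k
take-applyUpTo s z≤n       = refl
take-applyUpTo s (s≤s k≤n) = cong (s 0 ∷_) (take-applyUpTo (s ∘ suc) k≤n)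

module Unfold {X : Set} (move : ℕ → List X → X) where

  -- Each letter depends on the whole prefix before it. The prefixes are built by structural
  -- recursion, and `unfold-move` recovers the intended equation.
  history : ℕ → List X
  history zero    = []
  history (suc t) = history t ∷ʳ move t (history t)

  unfold : ℕ → X
  unfold t = move t (history t)

  history-unfold : ∀ t → history t ≡ applyUpTo unfold t
  history-unfold zero    = refl
  history-unfold (suc t) = trans (cong (_∷ʳ unfold t) (history-unfold t)) (applyUpTo-∷ʳ unfold t)

  unfold-move : ∀ t → unfold t ≡ move t (applyUpTo unfold t)
  unfold-move t = cong (move t) (history-unfold t)

module Reduction (c : List Instr) {h : ℕ} (c-length : length c ≡ suc h) (m d : ℕ) where

  open Loaded c m d
  open InputFormula m d
  open ProgramFormula c {3 + h} hiding (matched; next)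

  -- Two letters for loading and one for each of the `suc h` labels.
  A : Alphabet
  A = alphabet (3 + h) 1

  h-letter : Fin (3 + h)
  h-letter = fromℕ (2 + h)

  sentence : Sentence A
  sentence = programFormula h-letter ∧̇ widen h input

  -- System wins if the machine halts

  module Halting {τ : ℕ} (halted : PC τ ≡ 2 + h) where

    p = suc τ

    open Game A p 1
    open Words A p 1

    PC-< : ∀ {t} → t ≤ τ → PC t < 3 + h
    PC-< {t} t≤τ = subst (λ l → PC t < 2 + l) c-length
      (PC-bounded (subst (h <_) (sym c-length) (n<1+n h)) halted t≤τ)

    canonical : ∀ t → t ≤ τ → Σₛ
    canonical t t≤τ = fromℕ< (PC-< t≤τ) , fromℕ< {Proc t} {p} (s≤s (≤-trans (Proc-≤ t) t≤τ))

    -- Only the length of the history matters. Once Environment has moved, the further moves of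
    -- System come after a challenge and are unconstrained.
    strategy : Strategy
    strategy v with length v ≤? τ
    ... | yes v≤τ = just (canonical (length v) v≤τ)
    ... | no  _   = nothing

    strategy-just : ∀ v {a r} → strategy v ≡ just (a , r) →
                    length v ≤ τ × toℕ a ≡ PC (length v) × toℕ r ≡ Proc (length v)
    strategy-just v eq with length v ≤? τ
    strategy-just v refl | yes v≤τ = v≤τ , toℕ-fromℕ< _ , toℕ-fromℕ< _

    strategy-nothing : ∀ v → strategy v ≡ nothing → τ < length v
    strategy-nothing v eq with length v ≤? τ
    strategy-nothing v eq | no v≰τ = ≰⇒> v≰τ

    module _ (w : Word) (compatible : Compatible strategy w) where

      private
        systemMove : ∀ i {a r} → letter w i ≡ inj₁ (a , r) →
                     index w i ≤ τ × toℕ a ≡ PC (index w i) × toℕ r ≡ Proc (index w i)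
        systemMove i {a} {r} eq =
          subst (λ t → t ≤ τ × toℕ a ≡ PC t × toℕ r ≡ Proc t) (length-before w i)
            (strategy-just (before w i) (proj₁ compatible i (a , r) eq))

        -- The strategy moves on all histories of length at most `τ`, so a compatible finite word is
        -- longer than `τ`.
        position : ∀ t → t ≤ τ → ∃ λ i → index w i ≡ t
        position t t≤τ = go w (proj₂ compatible)
          where
          go : ∀ w → (∀ u → w ≡ fin u → strategy u ≡ nothing) → ∃ λ i → index w i ≡ t
          go (fin u) stops =
            let t<u = ≤-<-trans t≤τ (strategy-nothing u (stops u refl))
            in fromℕ< t<u , toℕ-fromℕ< t<u
          go (inf s) _     = t , refl

        Unchallenged : ℕ → Set
        Unchallenged N = ∀ i → index w i < N → ∃₂ λ a r → letter w i ≡ inj₁ (a , r)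

        Challenged : ℕ → Set
        Challenged N = ∃₂ λ i e → index w i ≡ N × letter w i ≡ inj₂ e

        search : ∀ N → N ≤ suc τ → Unchallenged N ⊎ (∃ λ N′ → N′ ≤ τ × Unchallenged N′ × Challenged N′)
        search zero    _    = inj₁ λ _ ()
        search (suc N) N≤τ with search N (<⇒≤ N≤τ) | position N (≤-pred N≤τ)
        ... | inj₂ found | _ = inj₂ found
        ... | inj₁ unch  | j , j≡N with letter w j in eq
        ...   | inj₂ e = inj₂ (N , ≤-pred N≤τ , unch , j , e , j≡N , eq)
        ...   | inj₁ (a , r) = inj₁ λ i i<1+N → at-most i (m<1+n⇒m<n∨m≡n i<1+N)
          where
          at-most : ∀ i → index w i < N ⊎ index w i ≡ N → ∃₂ λ a r → letter w i ≡ inj₁ (a , r)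
          at-most i (inj₁ i<N) = unch i i<N
          at-most i (inj₂ i≡N) with index-injective w (trans i≡N (sym j≡N))
          ... | refl = a , r , eq

        shape : ∀ {N} → N ≤ suc τ → Unchallenged N →
                (∀ i → N ≤ index w i → ∃₂ λ j e → index w j ≤ index w i × letter w j ≡ inj₂ e) → Shape w PC Proc N
        shape N≤ unch challenged = record
          { played     = λ i i<N → let a , r , eq = unch i i<N in a , r , eq , proj₂ (systemMove i eq)
          ; position   = λ t t<N → position t (≤-pred (≤-trans t<N N≤))
          ; challenged = challenged
          }

        satisfied : ∀ {N} → Shape w PC Proc N → w ⊨ halting h-letter → w ⊨ sentence
        satisfied {N} shape halts =
          let inp , sim = SimulationWide.good-elim c w shape m d (canonical-good N)
          in ((λ ¬∃ → ¬∃ (inj₂ (inj₂ zero) , zero , refl)) , halts , sim) , inp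

        open Structure w
        open Semantics w

      win : w ⊨ sentence
      win with search (suc τ) ≤-refl
      ... | inj₂ (N , N≤τ , unch , j , e , refl , eq) =
        satisfied (shape (m≤n⇒m≤1+n N≤τ) unch λ i N≤i → j , e , N≤i , eq)
          (⇒-intro (tt , tt) unchallenged (reaches h-letter) λ ¬challenge _ →
            ¬challenge λ ¬∃ → ¬∃ (inj₁ j , challenge-letter e eq))
        where
        challenge-letter : ∀ {i} e → letter w i ≡ inj₂ e → HasAction (inj₂ zero) (inj₁ i)
        challenge-letter (zero , _) eq = cong action eq
      ... | inj₁ unch =
        satisfied full (⇒-intro (tt , tt) unchallenged (reaches h-letter) λ _ ¬∃ →
          let i , i≡τ = position τ ≤-refl in
          ¬∃ (inj₁ i , Meaning.letter-intro w full (subst (_< suc τ) (sym i≡τ) (n<1+n τ))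
            (trans (toℕ-fromℕ (2 + h)) (sym (trans (cong PC i≡τ) halted)))))
        where
        -- The strategy is silent after time `τ`, so any letter there is itself a challenge.
        late : ∀ i → suc τ ≤ index w i → ∃₂ λ j e → index w j ≤ index w i × letter w j ≡ inj₂ e
        late i τ<i with letter w i in eq
        ... | inj₁ _ = ⊥-elim (<⇒≱ τ<i (proj₁ (systemMove i eq)))
        ... | inj₂ e = i , e , ≤-refl , eq
        full : Shape w PC Proc (suc τ)
        full = shape ≤-refl unch late

  halts⇒synth : (∃ λ τ → PC τ ≡ 2 + h) → PartSynth (A , sentence)
  halts⇒synth (τ , halted) =
    suc τ , 1 , Halting.strategy halted , λ w compatible _ → Halting.win halted w compatible

  -- System loses if the machine diverges

  module Diverging (diverges : ∀ t → PC t ≢ 2 + h) {p q : ℕ}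
                   (S : Game.Strategy A p q) (winning : Game.Winning A p q S sentence) where

    open Game A p q
    open Words A p q

    compatible-fin : ∀ (s : ℕ → Letter) {T} → (∀ t σ → t < T → s t ≡ inj₁ σ → S (applyUpTo s t) ≡ just σ) →
                     S (applyUpTo s T) ≡ nothing → Compatible S (fin (applyUpTo s T))
    compatible-fin s {T} moves passes =
      (λ i σ eq →
        let i<T = subst (toℕ i <_) (length-applyUpTo s T) (toℕ<n i) in
        trans (cong S (take-applyUpTo s (<⇒≤ i<T)))
          (moves (toℕ i) σ i<T (trans (sym (lookup-applyUpTo s T i)) eq))) ,
      λ { _ refl → passes }

    no-stop-at-start : S [] ≢ nothing
    no-stop-at-start passes =
      let w = fin []
          open Semantics w
          (_ , halts , _) , _ = winning w ((λ ()) , λ { _ refl → passes }) (fair-fin S [])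
      in ⇒-elim (tt , tt) unchallenged (reaches h-letter) halts
           (λ ∃c → ∃c λ { (inj₁ () , _) }) λ { (inj₁ () , _) }

    -- The letter `σ₀` stands in whenever System passes, which makes `solo` total before
    -- `always-plays` shows that System never passes. The first move of System provides such a
    -- letter; if there is none, the empty word refutes the strategy.
    module _ (σ₀ : Σₛ) where

      open Unfold {Letter} (λ _ v → inj₁ (fromMaybe σ₀ (S v))) renaming (unfold to solo; unfold-move to solo-move)

      a : ℕ → Σₛ
      a t = fromMaybe σ₀ (S (applyUpTo solo t))

      pc proc : ℕ → ℕ
      pc   = toℕ ∘ proj₁ ∘ a
      proc = toℕ ∘ proj₂ ∘ a

      Plays : ℕ → Set
      Plays t = S (applyUpTo solo t) ≡ just (a t)

      -- Environment challenges at time n, and before and after that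
      -- whenever System does not move; this makes the play fair.
      module Challenge (e : Σₑ) (n : ℕ) (plays : ∀ t → t < n → Plays t) where

        respond : ∀ {t} → Dec (t ≡ n) → Maybe Σₛ → Letter
        respond (yes _) _ = inj₂ e
        respond (no _)  r = maybe inj₁ (inj₂ e) r

        open Unfold (λ t v → respond (t ≟ n) (S v)) renaming (unfold to s; unfold-move to s-move)

        respond-system : ∀ {t} (t≟n : Dec (t ≡ n)) r {σ} → respond t≟n r ≡ inj₁ σ → r ≡ just σ
        respond-system (no _) (just _) refl = refl

        respond-just : ∀ {t} (t≟n : Dec (t ≡ n)) {r σ} → t ≢ n → r ≡ just σ → respond t≟n r ≡ inj₁ σ
        respond-just (yes t≡n) t≢n _    = ⊥-elim (t≢n t≡n)
        respond-just (no _)    t≢n refl = refl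

        respond-n : ∀ (n≟n : Dec (n ≡ n)) r → respond n≟n r ≡ inj₂ e
        respond-n (yes _)  _ = refl
        respond-n (no n≢n) _ = ⊥-elim (n≢n refl)

        agree : ∀ t → t ≤ n → applyUpTo s t ≡ applyUpTo solo t
        agree-at : ∀ t → t < n → s t ≡ inj₁ (a t)
        agree zero    _   = refl
        agree (suc t) t<n = trans (sym (applyUpTo-∷ʳ s t)) (trans (cong₂ _∷ʳ_ (agree t (<⇒≤ t<n))
          (trans (agree-at t t<n) (sym (solo-move t)))) (applyUpTo-∷ʳ solo t))
        agree-at t t<n = trans (s-move t)
          (respond-just (t ≟ n) (<⇒≢ t<n) (trans (cong S (agree t (<⇒≤ t<n))) (plays t t<n)))

        compatible : Compatible S (inf s)
        compatible = (λ i σ eq → respond-system (i ≟ n) _ (trans (sym (s-move i)) eq)) , λ _ ()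

        fair : Fair S (inf s)
        -- Beyond `n` every move that System wants to make is played; only at time `n` is it
        -- overridden.
        fair often k ¬∃ = often (k ⊔ suc n) λ (i , le , moves) →
          ¬∃ (i , ≤-trans (m≤m⊔n k (suc n)) le , system i (≤-trans (m≤n⊔m k (suc n)) le) moves)
          where
          system : ∀ i → n < i → S (applyUpTo s i) ≢ nothing → ∃ λ σ → s i ≡ inj₁ σ
          system i n<i moves with S (applyUpTo s i) in eq
          ... | just σ  = σ , trans (s-move i) (respond-just (i ≟ n) (>⇒≢ n<i) eq)
          ... | nothing = ⊥-elim (moves refl)

        shape : Shape (inf s) pc proc n
        shape = record
          { played     = λ t t<n → proj₁ (a t) , proj₂ (a t) , agree-at t t<n , refl , refl
          ; position   = λ t _ → t , refl
          ; challenged = λ t n≤t → n , e , n≤t , trans (s-move n) (respond-n (n ≟ n) _)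
          }

        good : Good pc proc n
        good =
          let (_ , _ , sim) , inp = winning (inf s) compatible fair
          in SimulationWide.good-intro c (inf s) shape m d inp sim

      -- Here `w` is `solo` or a finite prefix of it. The sentence provides an Environment process
      -- and thus a challenge at any time, so by `tracks` the letters are those of the machine. As
      -- `w` is unchallenged, it must contain the halting letter, which the machine never reaches.
      refute : ∀ w → w ⊨ sentence → (∀ i → letter w i ≡ inj₁ (a (index w i))) →
               (∀ i t → t ≤ index w i → Plays t) → ⊥
      refute w ((env-exists , halts , _) , _) letters plays =
        env-exists λ { (_ , r , refl) →
          ⇒-elim (tt , tt) unchallenged (reaches h-letter) halts
            (λ ∃c → ∃c λ { (inj₁ i , eq) → system (letters i) eq ; (inj₂ _ , ()) })
            λ { (inj₁ i , eq) → halt-reached i (zero , r) eq ; (inj₂ _ , ()) } }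
        where
        open Semantics w
        system : ∀ {i} → letter w i ≡ inj₁ (a (index w i)) → action (letter w i) ≢ inj₂ zero
        system eq rewrite eq = λ ()
        halt-reached : ∀ i → Σₑ → action (letter w i) ≢ inj₁ h-letter
        halt-reached i e eq = diverges (index w i) (trans (sym
          (proj₁ (tracks {k = suc (index w i)}
            (λ n n≤ → Challenge.good e n λ t t<n → plays i t (≤-pred (≤-trans t<n n≤)))
            (index w i) (n<1+n _))))
          (trans (cong toℕ (inj₁-injective (trans (sym (cong action (letters i))) eq))) (toℕ-fromℕ (2 + h))))

      solo-system : ∀ t σ → Plays t → solo t ≡ inj₁ σ → S (applyUpTo solo t) ≡ just σ
      solo-system t σ play eq = trans play (cong just (inj₁-injective (trans (sym (solo-move t)) eq)))

      -- If System passed at a first time `T`, the prefix of length `T` would be a complete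
      -- compatible play, which `refute` excludes.
      always-plays : ∀ t → Plays t
      always-plays = <-rec Plays λ T plays → extend T (λ t t<T → plays t<T)
        where
        extend : ∀ T → (∀ t → t < T → Plays t) → Plays T
        extend T plays with S (applyUpTo solo T) in eq
        ... | just _  = refl
        ... | nothing = ⊥-elim (refute (fin (applyUpTo solo T))
          (winning _ (compatible-fin solo (λ t σ t<T → solo-system t σ (plays t t<T)) eq) (fair-fin S _))
          (λ i → trans (lookup-applyUpTo solo T i) (solo-move (toℕ i)))
          λ i t t≤i → plays t (≤-<-trans t≤i (subst (toℕ i <_) (length-applyUpTo solo T) (toℕ<n i))))

      solo-loses : ⊥
      solo-loses = refute (inf solo)
        (winning (inf solo) ((λ t σ → solo-system t σ (always-plays t)) , λ _ ())
          λ _ k ¬∃ → ¬∃ (k , ≤-refl , a k , solo-move k))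
        solo-move λ _ t _ → always-plays t

    impossible : ⊥
    impossible with S [] in eq
    ... | nothing = no-stop-at-start eq
    ... | just σ  = solo-loses σ

  diverges⇒¬synth : (∀ t → PC t ≢ 2 + h) → ¬ PartSynth (A , sentence)
  diverges⇒¬synth diverges (p , q , S , winning) = Diverging.impossible diverges S winning

-- Self-reference

-- The codes of concrete formulas are enormous unary numbers, which must
-- not be unfolded.
opaque

  pair : ℕ → ℕ → ℕ
  pair = ⟨_,_⟩

  codeF : ∀ {A a b} → Formula A a b → ℕ
  codeF = codeFormula

  pairᶜ : ∀ {k} {F G : Vec ℕ k → ℕ} → Computable F → Computable G → Computable λ v → pair (F v) (G v)
  pairᶜ = ⟨,⟩ᶜ

  codeF-¬ : ∀ {A a b} (φ : Formula A a b) → codeF (¬̇ φ) ≡ pair 7 (codeF φ)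
  codeF-¬ φ = refl

  codeF-∧ : ∀ {A a b} (φ ψ : Formula A a b) → codeF (φ ∧̇ ψ) ≡ pair 8 (pair (codeF φ) (codeF ψ))
  codeF-∧ φ ψ = refl

  codeF-∃x : ∀ {A a b} (φ : Formula A true b) → codeF {A} {a} (∃x φ) ≡ pair 10 (codeF φ)
  codeF-∃x φ = refl

  codeF-∀x : ∀ {A a b} (φ : Formula A true b) → codeF {A} {a} (∀x φ) ≡ pair 11 (codeF φ)
  codeF-∀x φ = refl

  codeF-∃y : ∀ {A a b} (φ : Formula A a true) → codeF {A} {a} {b} (∃y φ) ≡ pair 12 (codeF φ)
  codeF-∃y φ = refl

  -- The code is `⟨ 1 , ⟨ 0 , 0 ⟩ ⟩`, that is `triangle 1`.
  codeF-≐ : ∀ {A b} → codeF {A} {true} {b} (x ≐ x) ≡ 1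
  codeF-≐ = refl

  codeF-widen : ∀ {n a b} k (φ : Formula (alphabet n 1) a b) → codeF (widen k φ) ≡ codeF φ
  codeF-widen = code-widen

  codeI : Instance → ℕ
  codeI = code

  codeI-code : ∀ I → codeI I ≡ code I
  codeI-code I = refl

  codeI-pair : ∀ A (φ : Sentence A) → codeI (A , φ) ≡ pair (Alphabet.#S A) (pair (Alphabet.#E A) (codeF φ))
  codeI-pair A φ = refl

-- Computability of the codes of formulas

module _ {A : Alphabet} {k : ℕ} where

  Computableᶠ : ∀ {a b} → (Vec ℕ k → Formula A a b) → Set
  Computableᶠ φ = Computable λ v → codeF (φ v)

  cast : {F G : Vec ℕ k → ℕ} → (∀ v → G v ≡ F v) → Computable F → Computable G
  cast eq (f , f⇓) = f , λ v → subst (f [ v ]⇓_) (sym (eq v)) (f⇓ v)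

  formulaᶜ : ∀ {a b} (φ : Formula A a b) → Computableᶠ λ _ → φ
  formulaᶜ φ = constᶜ (codeF φ)

  ¬ᶜ : ∀ {a b} {φ : Vec ℕ k → Formula A a b} → Computableᶠ φ → Computableᶠ λ v → ¬̇ φ v
  ¬ᶜ {φ = φ} φᶜ = cast (λ v → codeF-¬ (φ v)) (pairᶜ (constᶜ 7) φᶜ)

  ∧ᶜ : ∀ {a b} {φ ψ : Vec ℕ k → Formula A a b} → Computableᶠ φ → Computableᶠ ψ → Computableᶠ λ v → φ v ∧̇ ψ v
  ∧ᶜ {φ = φ} {ψ} φᶜ ψᶜ = cast (λ v → codeF-∧ (φ v) (ψ v)) (pairᶜ (constᶜ 8) (pairᶜ φᶜ ψᶜ))

  ⇒ᶜ : ∀ {a b} {φ ψ : Vec ℕ k → Formula A a b} → Computableᶠ φ → Computableᶠ ψ → Computableᶠ λ v → φ v ⇒̇ ψ v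
  ⇒ᶜ {φ = φ} {ψ} φᶜ ψᶜ = ¬ᶜ {φ = λ v → φ v ∧̇ ¬̇ ψ v} (∧ᶜ {φ = φ} {λ v → ¬̇ ψ v} φᶜ (¬ᶜ {φ = ψ} ψᶜ))

  ∀xᶜ : ∀ {a b} {φ : Vec ℕ k → Formula A true b} → Computableᶠ φ → Computableᶠ {a} λ v → ∀x (φ v)
  ∀xᶜ {φ = φ} φᶜ = cast (λ v → codeF-∀x (φ v)) (pairᶜ (constᶜ 11) φᶜ)

module _ {n : ℕ} where

  -- Under its quantifiers `atLeast` recurs with `b = true`. Codes do not see this index, so the
  -- iteration can be carried out for `true` alone.
  atLeast-code : ∀ {b} l → codeF (atLeast {n} {b} l) ≡ codeF (atLeast {n} {true} l)
  atLeast-code zero    = trans codeF-≐ (sym codeF-≐)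
  atLeast-code (suc l) = trans (codeF-∃y _) (sym (codeF-∃y _))

  private
    y≺x x≐y : ℕ
    y≺x = codeF {alphabet n 1} (y {true} ≺ x)
    x≐y = codeF {alphabet n 1} (x ≐ y {true})

    next-code : ℕ → ℕ
    next-code i = pair 12 (pair 8 (pair y≺x (pair 10 (pair 8 (pair x≐y i)))))

    atLeast-suc : ∀ l → codeF (atLeast {n} {true} (suc l)) ≡ next-code (codeF (atLeast {n} {true} l))
    atLeast-suc l = trans (codeF-∃y _) (cong (pair 12) (trans (codeF-∧ _ _) (cong (pair 8) (cong (pair y≺x)
      (trans (codeF-∃x _) (cong (pair 10) (codeF-∧ _ _)))))))

    headᶜ : Computable {1} Vec.head
    headᶜ = proj zero , λ { (_ ∷ []) → proj }

    next-codeᶜ : Computable {1} (next-code ∘ Vec.head)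
    next-codeᶜ = pairᶜ (constᶜ 12) (pairᶜ (constᶜ 8) (pairᶜ (constᶜ y≺x)
      (pairᶜ (constᶜ 10) (pairᶜ (constᶜ 8) (pairᶜ (constᶜ x≐y) headᶜ)))))

  atLeastᶜ : ∀ {k b} {F : Vec ℕ k → ℕ} → Computable F → Computableᶠ λ v → atLeast {n} {b} (F v)
  atLeastᶜ {F = F} Fᶜ = cast {alphabet n 1} (λ v → atLeast-code (F v))
    (compᶜ₁ F₁ (iterateᶜ F₁ {next-code} atLeast-suc next-codeᶜ) Fᶜ)
    where
    F₁ : ℕ → ℕ
    F₁ l = codeF (atLeast {n} {true} l)

-- The code of the instance with m System actions whose sentence is the
-- conjunction of the sentence with code d and of input m d.
selfCode : ℕ → ℕ → ℕ
selfCode m d = pair m (pair 1 (pair 8 (pair d (codeF (InputFormula.input m d)))))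

selfCodeᶜ : Computable {2} λ v → selfCode (lookup v zero) (lookup v (suc zero))
selfCodeᶜ = pairᶜ mᶜ (pairᶜ (constᶜ 1) (pairᶜ (constᶜ 8) (pairᶜ dᶜ inputᶜ)))
  where
  m d : Vec ℕ 2 → ℕ
  m v = lookup v zero
  d v = lookup v (suc zero)
  mᶜ : Computable m
  mᶜ = projᶜ zero
  dᶜ : Computable d
  dᶜ = projᶜ (suc zero)
  windowᶜ : ∀ {F G : Vec ℕ 2 → ℕ} i → Computable F → Computable G →
            Computableᶠ λ v → InputFormula.window (m v) (d v) (F v) (G v) i
  windowᶜ {F} {G} i Fᶜ Gᶜ =
    ⇒ᶜ {φ = λ v → atLeast (F v) ∧̇ ¬̇ atLeast (G v)}
      (∧ᶜ {φ = λ v → atLeast (F v)} (atLeastᶜ Fᶜ) (¬ᶜ {φ = λ v → atLeast (G v)} (atLeastᶜ Gᶜ)))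
      (formulaᶜ (act (inj₁ i) x))
  inputᶜ : Computableᶠ λ v → InputFormula.input (m v) (d v)
  inputᶜ = ∀xᶜ {φ = λ v → active ⇒̇ InputFormula.windows (m v) (d v)}
    (⇒ᶜ {φ = λ _ → active} (formulaᶜ active)
      (∧ᶜ {φ = λ v → InputFormula.window (m v) (d v) 0 (m v) zero} (windowᶜ zero (constᶜ 0) mᶜ)
        (∧ᶜ {φ = λ v → InputFormula.window (m v) (d v) (m v) (m v + d v) (suc zero)}
          (windowᶜ (suc zero) mᶜ (+ᶜ mᶜ dᶜ))
          (windowᶜ (suc (suc zero)) (+ᶜ mᶜ dᶜ) (sucᶜ (+ᶜ mᶜ dᶜ))))))

module _ (F : Rec 2) where

  open Machine F

  -- Independent of the inputs, so it can itself be used as the input `d`.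
  programCode : ℕ
  programCode = codeF (ProgramFormula.programFormula program (fromℕ (2 + halt)))

  module _ (m d : ℕ) where

    open Loaded program m d
    module R = Reduction program program-length m d

    gameInstance : Instance
    gameInstance = R.A , R.sentence

    gameInstance-code : codeI gameInstance ≡
      pair (3 + halt) (pair 1 (pair 8 (pair programCode (codeF (InputFormula.input m d)))))
    gameInstance-code = trans (codeI-pair R.A R.sentence) (cong (λ i → pair (3 + halt) (pair 1 i))
      (trans (codeF-∧ φ (widen halt ψ)) (cong (λ i → pair 8 (pair (codeF φ) i)) (codeF-widen halt ψ))))
      where
      φ : Sentence R.A
      φ = ProgramFormula.programFormula program R.h-letter
      ψ : Sentence (alphabet 3 1)
      ψ = InputFormula.input m d

    zero⇒synth : F [ m ∷ d ∷ [] ]⇓ 0 → PartSynth gameInstance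
    zero⇒synth F⇓ = R.halts⇒synth (PC-halts (halts σ₀-0 σ₀-1 F⇓))

    suc⇒¬synth : ∀ {k} → F [ m ∷ d ∷ [] ]⇓ suc k → ¬ PartSynth gameInstance
    suc⇒¬synth F⇓ = R.diverges⇒¬synth (PC-diverges (diverges σ₀-0 σ₀-1 F⇓))

-- The equations keep m and d from being unfolded.
reduction : ∀ F m d → m ≡ 3 + Machine.halt F → d ≡ programCode F →
            ∃ λ I → code I ≡ selfCode m d ×
            (F [ m ∷ d ∷ [] ]⇓ 0 → PartSynth I) × (F [ m ∷ d ∷ [] ]⇓ 1 → ¬ PartSynth I)
reduction F m d m≡ d≡ =
  gameInstance F m d ,
  trans (sym (codeI-code (gameInstance F m d))) (trans (gameInstance-code F m d)
    (cong₂ (λ i j → pair i (pair 1 (pair 8 (pair j (codeF (InputFormula.input m d)))))) (sym m≡) (sym d≡))) ,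
  zero⇒synth F m d , suc⇒¬synth F m d

-- On `m` and `d`, `F` returns the answer of `f` on `I` itself. As `PartSynth I` is not known to be
-- decided, its negation is proved first: a proof of it makes `f` answer 1, which makes `I` lost.
-- The negation in turn makes `f` answer 0, which makes `I` won.
undecidable : ∀ f m d (I : Instance) → code I ≡ selfCode m d →
              let F = comp f (proj₁ selfCodeᶜ ∷ []) in
              (F [ m ∷ d ∷ [] ]⇓ 0 → PartSynth I) → (F [ m ∷ d ∷ [] ]⇓ 1 → ¬ PartSynth I) →
              ¬ Decides code PartSynth f
undecidable f m d I code≡ synth ¬synth decides = ¬P (synth (value (proj₂ (decides I) ¬P)))
  where
  value : ∀ {k} → f [ code I ∷ [] ]⇓ k → comp f (proj₁ selfCodeᶜ ∷ []) [ m ∷ d ∷ [] ]⇓ k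
  value f⇓ = comp (proj₂ selfCodeᶜ (m ∷ d ∷ []) ∷ []) (subst (λ i → f [ i ∷ [] ]⇓ _) code≡ f⇓)
  ¬P : ¬ PartSynth I
  ¬P P = ¬synth (value (proj₁ (decides I) P)) P

theorem3 : Undecidable code PartSynth
theorem3 (f , decides) =
  let I , code≡ , synth , ¬synth = reduction F _ _ refl refl
  in undecidable f (3 + Machine.halt F) (programCode F) I code≡ synth ¬synth decides
  where
  F : Rec 2
  F = comp f (proj₁ selfCodeᶜ ∷ [])
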